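{- (ZF) For every infinite set $A$ and every natural number $n$, $|\mathrm{seq}_{\leq n}(A)|<|\mathrm{Part}_{\mathrm{fin}}(A)|$.
   Context: Work in ZF (no Axiom of Choice). $\mathrm{seq}_{\le n}(A)$ is the set of finite sequences of elements of $A$ of length at most $n$; $\mathrm{Part}_{\mathrm{fin}}(A)$ is the set of all partitions of $A$ all of whose blocks are finite. $|X|<|Y|$ means there is an injection from $X$ into $Y$ and there is no bijection between $X$ and $Y$. -}

module Defs where

-- Sets, without the axiom of choice.  A set is a setoid.  Propositions are read
-- classically through the double-negation translation: "there exists" is ∃ᶜ,
-- and an equality asserted to hold is ¬ ¬ (x ≈ y) unless it is already ¬¬-stable.

open import Level using (Level; _⊔_; suc)
open import Data.Bool.Base using (Bool; T)
import Data.Bool.Properties as Bool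
open import Data.Fin.Base using (Fin)
open import Data.List.Base using (length)
open import Data.List.Relation.Binary.Equality.Setoid using (≋-setoid)
open import Data.Nat.Base using (ℕ; _≤_)
open import Data.Product.Base using (∃; _×_; _,_; proj₁)
open import Data.Product.Relation.Binary.Pointwise.NonDependent using (_×ₛ_)
open import Function.Bundles using (_⟨$⟩_)
open import Function.Relation.Binary.Setoid.Equality using (_⇨_)
open import Relation.Binary.Bundles using (Setoid)
import Relation.Binary.Construct.On as On
import Relation.Binary.PropositionalEquality.Properties as ≡
open import Relation.Nullary.Decidable.Core using (Dec)
open import Relation.Nullary.Negation.Core using (¬_; Stable)

open Setoid using (Carrier)

private
  variable
    a b c d e ℓ : Level

-- Excluded middle for (¬¬-stable) propositions.  Excluded middle for all types,
-- as in Axiom.ExcludedMiddle, would yield P from ¬ ¬ P for every type P, hence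
-- choice functions; this form extracts no element from ¬ ¬ P, so it does not
-- turn ∃ᶜ into Σ.
ClassicalLogic : (ℓ : Level) → Set (suc ℓ)
ClassicalLogic ℓ = {P : Set ℓ} → Stable P → Dec P

∃ᶜ : {X : Set a} → (X → Set b) → Set (a ⊔ b)
∃ᶜ P = ¬ ¬ ∃ P

-- Subsets are extensional characteristic functions, equal when they have the
-- same elements.  Under ClassicalLogic every predicate (at its level) that
-- respects ≈ has one, up to double negation.
𝒫 : Setoid c e → Setoid (c ⊔ e) c
𝒫 S = S ⇨ ≡.setoid Bool

infix 4 _∈_
_∈_ : {S : Setoid c e} → Carrier S → Carrier (𝒫 S) → Set
x ∈ P = T (P ⟨$⟩ x)

Elements : (S : Setoid c e) → Carrier (𝒫 S) → Setoid c e
Elements S P = On.setoid S (proj₁ {B = λ x → _∈_ {S = S} x P})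

-- A function between sets is its graph.  Agda functions would be too few: there
-- is no way to extract one from a total single-valued relation.
module _ (S : Setoid a b) (S′ : Setoid c d) where

  private
    module S  = Setoid S
    module S′ = Setoid S′

  Relation : Set (a ⊔ b ⊔ c ⊔ d)
  Relation = Carrier (𝒫 (S ×ₛ S′))

  infix 4 _↦[_]_
  _↦[_]_ : S.Carrier → Relation → S′.Carrier → Set
  x ↦[ F ] y = _∈_ {S = S ×ₛ S′} (x , y) F

  record IsFunction (F : Relation) : Set (a ⊔ b ⊔ c ⊔ d) where
    field
      total        : ∀ x → ∃ᶜ λ y → x ↦[ F ] y
      singleValued : ∀ {x y y′} → x ↦[ F ] y → x ↦[ F ] y′ → ¬ ¬ (y S′.≈ y′)

  record IsInjection (F : Relation) : Set (a ⊔ b ⊔ c ⊔ d) where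
    field
      isFunction : IsFunction F
      injective  : ∀ {x x′ y} → x ↦[ F ] y → x′ ↦[ F ] y → ¬ ¬ (x S.≈ x′)

  record IsBijection (F : Relation) : Set (a ⊔ b ⊔ c ⊔ d) where
    field
      isInjection : IsInjection F
      surjective  : ∀ y → ∃ᶜ λ x → x ↦[ F ] y

infix 4 ∣_∣≤∣_∣ ∣_∣≡∣_∣ ∣_∣<∣_∣

∣_∣≤∣_∣ : Setoid a b → Setoid c d → Set (a ⊔ b ⊔ c ⊔ d)
∣ S ∣≤∣ S′ ∣ = ∃ᶜ (IsInjection S S′)

∣_∣≡∣_∣ : Setoid a b → Setoid c d → Set (a ⊔ b ⊔ c ⊔ d)
∣ S ∣≡∣ S′ ∣ = ∃ᶜ (IsBijection S S′)

∣_∣<∣_∣ : Setoid a b → Setoid c d → Set (a ⊔ b ⊔ c ⊔ d)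
∣ S ∣<∣ S′ ∣ = ∣ S ∣≤∣ S′ ∣ × ¬ ∣ S ∣≡∣ S′ ∣

Finite : Setoid c e → Set (c ⊔ e)
Finite S = ∃ᶜ λ (k : ℕ) → ∣ S ∣≡∣ ≡.setoid (Fin k) ∣

-- Mere negation of Finite: no sequence of distinct elements is provided.
Infinite : Setoid c e → Set (c ⊔ e)
Infinite S = ¬ Finite S

seq≤ : ℕ → Setoid c e → Setoid c (c ⊔ e)
seq≤ n A = On.setoid (≋-setoid A) (proj₁ {B = λ xs → length xs ≤ n})

module _ (A : Setoid c e) where

  private
    module 𝒫A = Setoid (𝒫 A)

    infix 4 _∈ₚ_ _∈ᵦ_
    _∈ₚ_ : Carrier A → 𝒫A.Carrier → Set
    _∈ₚ_ = _∈_ {S = A}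

    _∈ᵦ_ : 𝒫A.Carrier → Carrier (𝒫 (𝒫 A)) → Set
    _∈ᵦ_ = _∈_ {S = 𝒫 A}

  record IsPartition (Π : Carrier (𝒫 (𝒫 A))) : Set (c ⊔ e) where
    field
      nonempty : ∀ {P} → P ∈ᵦ Π → ∃ᶜ λ x → x ∈ₚ P
      disjoint : ∀ {P Q x} → P ∈ᵦ Π → Q ∈ᵦ Π → x ∈ₚ P → x ∈ₚ Q → P 𝒫A.≈ Q
      covering : ∀ x → ∃ᶜ λ P → P ∈ᵦ Π × x ∈ₚ P

  record IsFinitaryPartition (Π : Carrier (𝒫 (𝒫 A))) : Set (c ⊔ e) where
    field
      isPartition  : IsPartition Π
      finiteBlocks : ∀ {P} → P ∈ᵦ Π → Finite (Elements A P)

  Part-fin : Setoid (c ⊔ e) (c ⊔ e)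
  Part-fin = On.setoid (𝒫 (𝒫 A)) (proj₁ {B = IsFinitaryPartition})

{-# OPTIONS --safe #-}

-- Sequences are written into finitary partitions with the help of finitely many
-- markers: an entry of the sequence shares its block with the marker of its
-- position.
--
-- Conversely let G be an injection of the finitary partitions into the sequences
-- of length at most n.  Composing it with the previous injection for length
-- 2n + 1, a finite set of m ≥ 2 elements yields m ^ (2n + 1) sequences, more than
-- the (1 + m) ^ n which can be written with these elements; so some value of G
-- has an entry outside the set, and ω embeds in A.  Next, let H be the Hartogs
-- number of A.  The words over H (and two bits) are well-ordered by their largest
-- letter first, and they are mapped injectively to A by transfinite recursion.  At
-- a word with largest letter β, the words over the letters below β have been
-- treated, and there are few enough predecessors that the sequences of
-- predecessors are coded by words over the letters below β.  A diagonal set of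
-- such words is turned into a partition by joining the images of 0w and 1w for
-- the words w in the set; the value of G at this partition has an entry which is
-- not the image of a predecessor, and this is the next image.  So H embeds in A,
-- a contradiction.
module Submission where

open import Defs
open import Level using (Level; _⊔_; Lift; lift; lower)
open import Data.Bool.Base using (Bool; true; false; T; not; _∧_; _∨_; if_then_else_)
open import Data.Bool.Properties using (T?; _≟_)
open import Data.Empty using (⊥; ⊥-elim)
open import Data.Fin.Base using (Fin; zero; suc; toℕ; fromℕ<; finToFun; funToFin; combine)
import Data.Fin.Properties as Fin
open import Data.List.Base using (List; []; _∷_; _++_; length; concat; tabulate; lookup; fromMaybe)
open import Data.List.Properties using (length-tabulate)
open import Data.List.Relation.Unary.All using (All; []; _∷_)
import Data.List.Relation.Unary.All as All
import Data.List.Relation.Unary.All.Properties as All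
open import Data.List.Relation.Unary.Any using (Any; here; there)
import Data.List.Relation.Unary.Any as Any
import Data.List.Relation.Unary.Any.Properties as Any
open import Data.List.Relation.Binary.Pointwise.Base using (Pointwise; []; _∷_)
import Data.List.Relation.Binary.Pointwise as Pw
open import Data.Maybe.Base using (Maybe; just; nothing)
open import Data.Nat.Base using (ℕ; zero; suc; _+_; _*_; _^_; _≤_; _<ᵇ_; s≤s; z≤n; s<s; z<s)
import Data.Nat.Base as ℕ
import Data.Nat.Properties as ℕ
open import Data.Nat.Induction using (<-rec)
open import Data.Product.Base using (∃; ∃₂; _×_; _,_; proj₁; proj₂)
open import Data.Sum.Base using (_⊎_; inj₁; inj₂; [_,_]′)
open import Data.Unit.Base using (⊤; tt)
open import Function.Base using (_∘_; id)
open import Function.Bundles using (Func; _⟨$⟩_)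
open import Relation.Binary.Bundles using (Setoid)
open import Relation.Binary.Structures using (IsEquivalence)
open import Relation.Binary.PropositionalEquality
  using (_≡_; _≢_; _≗_; refl; sym; trans; cong; cong₂; subst)
import Relation.Binary.PropositionalEquality.Properties as ≡
open import Relation.Nullary.Decidable.Core
  using (Dec; yes; no; ¬?; map′; isYes; toWitness; fromWitness; decidable-stable; ¬¬-excluded-middle)
open import Relation.Nullary.Negation.Core using (¬_; negated-stable; contradiction)

open Setoid using (Carrier)

private
  variable
    a b c e s t ℓ : Level

-- The double-negation monad and propositions as Booleans.

return : {P : Set a} → P → ¬ ¬ P
return p ¬p = ¬p p

infixl 1 _>>=_
_>>=_ : {P : Set a} {Q : Set b} → ¬ ¬ P → (P → ¬ ¬ Q) → ¬ ¬ Q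
(m >>= f) ¬q = m λ p → f p ¬q

em : (P : Set a) → ¬ ¬ Dec P
em P = ¬¬-excluded-middle

T-stable : ∀ {x} → ¬ ¬ T x → T x
T-stable {x} = decidable-stable (T? x)

T⇒≡ : ∀ {x y} → (T x → T y) → (T y → T x) → x ≡ y
T⇒≡ {false} {false} _ _ = refl
T⇒≡ {false} {true}  _ g = ⊥-elim (g _)
T⇒≡ {true}  {false} f _ = ⊥-elim (f _)
T⇒≡ {true}  {true}  _ _ = refl

-- The reasoning takes place in the double-negation monad; excluded middle only
-- serves to turn propositions into Booleans.
module Comprehension (lem : ClassicalLogic ℓ) where

  -- The double negation is stable whatever `P` is, so `lem` applies to it; this is why `truth` and
  -- `holds` speak of `¬ ¬ P`.
  ⟪_⟫ : Set ℓ → Bool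
  ⟪ P ⟫ = isYes (lem {¬ ¬ P} negated-stable)

  truth : {P : Set ℓ} → ¬ ¬ P → T ⟪ P ⟫
  truth = fromWitness

  holds : {P : Set ℓ} → T ⟪ P ⟫ → ¬ ¬ P
  holds = toWitness

-- Well-orders.

-- A strict order whose incomparability relation plays the role of equality.
record WellOrder (X : Set a) : Set a where
  infix 4 _<_ _≮_ _∼_
  field
    _<_       : X → X → Bool
    cotrans   : ∀ {x z} y → T (x < z) → T (x < y) ⊎ T (y < z)
    asym      : ∀ {x y} → T (x < y) → ¬ T (y < x)
    -- Predicates valued in `Bool` keep the record at the level of `X`; a proposition is passed to
    -- it through `⟪_⟫`.
    induction : (P : X → Bool) →
                (∀ x → (∀ y → T (y < x) → T (P y)) → T (P x)) → ∀ x → T (P x)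

  _≮_ : X → X → Set
  x ≮ y = ¬ T (x < y)

  _∼_ : X → X → Set
  x ∼ y = x ≮ y × y ≮ x

  irrefl : ∀ {x} → x ≮ x
  irrefl x<x = asym x<x x<x

  <-≮-trans : ∀ {x y z} → T (x < y) → z ≮ y → T (x < z)
  <-≮-trans {z = z} x<y z≮y with cotrans z x<y
  ... | inj₁ x<z = x<z
  ... | inj₂ z<y = contradiction z<y z≮y

  ≮-<-trans : ∀ {x y z} → y ≮ x → T (y < z) → T (x < z)
  ≮-<-trans {x = x} y≮x y<z with cotrans x y<z
  ... | inj₁ y<x = contradiction y<x y≮x
  ... | inj₂ x<z = x<z

  <-trans : ∀ {x y z} → T (x < y) → T (y < z) → T (x < z)
  <-trans x<y y<z = <-≮-trans x<y (asym y<z)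

  ≮-trans : ∀ {x y z} → x ≮ y → y ≮ z → x ≮ z
  ≮-trans {y = y} x≮y y≮z x<z with cotrans y x<z
  ... | inj₁ x<y = x≮y x<y
  ... | inj₂ y<z = y≮z y<z

  ∼-refl : ∀ {x} → x ∼ x
  ∼-refl = irrefl , irrefl

  ∼-sym : ∀ {x y} → x ∼ y → y ∼ x
  ∼-sym (p , q) = q , p

  ∼-trans : ∀ {x y z} → x ∼ y → y ∼ z → x ∼ z
  ∼-trans (p , q) (r , s) = ≮-trans p r , ≮-trans s q

-- The Hartogs number of a set.

-- The rank of a well-founded relation restricted to a set of nodes; ranks are
-- compared by simulations, which makes the comparison of ranks impredicatively
-- definable.
module Hartogs (lem : ClassicalLogic ℓ) (A : Set ℓ) where
  open Comprehension lem

  WellFounded : (A → A → Bool) → Set ℓ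
  WellFounded R = (P : A → Bool) →
    (∀ a → (∀ b → T (R b a) → T (P b)) → T (P a)) → ∀ a → T (P a)

  -- The rank of an imagined root whose children are the nodes in `top`; the root need not be an
  -- element of `A`. Ranks form a type at the level of `A`, so that `⟪_⟫` may quantify over them.
  record Rank : Set ℓ where
    field
      rel : A → A → Bool
      wf  : WellFounded rel
      top : A → Bool
  open Rank

  infix 6 _↓_
  _↓_ : Rank → A → Rank
  x ↓ a = record { rel = rel x ; wf = wf x ; top = λ b → rel x b a }

  _Simulates[_]_ : (A → Bool) → (A → A → Bool) → (A → Bool) → Set ℓ
  U′ Simulates[ S ] U = ∀ b → T (U b) → ∃ᶜ λ b′ → T (U′ b′) × T (S b b′)

  Simulation : (A → A → Bool) → Rank → Rank → Set ℓ
  Simulation S x y = ∀ a a′ → T (S a a′) → top (y ↓ a′) Simulates[ S ] top (x ↓ a)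

  infix 4 _⊑_ _⊏_
  _⊑_ : Rank → Rank → Set ℓ
  x ⊑ y = ∃ᶜ λ S → Simulation S x y × top y Simulates[ S ] top x

  _⊏_ : Rank → Rank → Set ℓ
  x ⊏ y = ∃ᶜ λ b → T (top y b) × x ⊑ y ↓ b

  ⊑-unfold : ∀ {x y b} → x ⊑ y → T (top x b) → x ↓ b ⊏ y
  ⊑-unfold x⊑y b∈x = do
    S , sim , f ← x⊑y
    b′ , b′∈y , s ← f _ b∈x
    return (b′ , b′∈y , return (S , sim , sim _ _ s))

  -- The comparison of ranks is itself a simulation between the nodes, and the hypothesis extends it
  -- to the two roots.
  ⊑-fold : ∀ {x y} → (∀ b → T (top x b) → x ↓ b ⊏ y) → x ⊑ y
  ⊑-fold {x} {y} f = return (S , simulation , λ b b∈ → relabel (top y) (f b b∈))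
    where
    S : A → A → Bool
    S a a′ = ⟪ x ↓ a ⊑ y ↓ a′ ⟫
    relabel : ∀ U {b} → (∃ᶜ λ b′ → T (U b′) × x ↓ b ⊑ y ↓ b′) → ∃ᶜ λ b′ → T (U b′) × T (S b b′)
    relabel U m = do
      b′ , b′∈ , s ← m
      return (b′ , b′∈ , truth (return s))
    simulation : Simulation S x y
    simulation a a′ s b b∈ =
      relabel (λ b′ → rel y b′ a′) (⊑-unfold {x ↓ a} {y ↓ a′} (holds s >>= id) b∈)

  ⊑-refl : ∀ {x} → x ⊑ x
  ⊑-refl {x} = return ((λ a a′ → ⟪ a ≡ a′ ⟫) , sim , λ b b∈ → return (b , b∈ , truth (return refl)))
    where
    sim : Simulation (λ a a′ → ⟪ a ≡ a′ ⟫) x x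
    sim a a′ s b b∈ = do
      refl ← holds s
      return (b , b∈ , truth (return refl))

  ⊑-trans : ∀ {x y z} → x ⊑ y → y ⊑ z → x ⊑ z
  ⊑-trans {x} {y} {z} x⊑y y⊑z = do
    S , sim , f ← x⊑y
    S′ , sim′ , f′ ← y⊑z
    let
      S″ : A → A → Bool
      S″ a c = ⟪ (∃ λ b → T (S a b) × T (S′ b c)) ⟫
      compose : ∀ {U V W} → V Simulates[ S ] U → W Simulates[ S′ ] V → W Simulates[ S″ ] U
      compose g g′ a a∈ = do
        b , b∈ , s ← g a a∈
        c , c∈ , s′ ← g′ b b∈
        return (c , c∈ , truth (return (b , s , s′)))
      sim″ : Simulation S″ x z
      sim″ a c s = λ d d∈ → do
        b , s , s′ ← holds s
        compose (sim a b s) (sim′ b c s′) d d∈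
    return (S″ , sim″ , compose f f′)

  ⊏-⊑-trans : ∀ {x y z} → x ⊏ y → y ⊑ z → x ⊏ z
  ⊏-⊑-trans {x} {y} {z} x⊏y y⊑z = do
    b , b∈y , x⊑b ← x⊏y
    b′ , b′∈z , b⊑b′ ← ⊑-unfold {y} {z} y⊑z b∈y
    return (b′ , b′∈z , ⊑-trans {x} {y ↓ b} {z ↓ b′} x⊑b b⊑b′)

  ⊑-⊏-trans : ∀ {x y z} → x ⊑ y → y ⊏ z → x ⊏ z
  ⊑-⊏-trans {x} {y} {z} x⊑y y⊏z = do
    b , b∈z , y⊑b ← y⊏z
    return (b , b∈z , ⊑-trans {x} {y} {z ↓ b} x⊑y y⊑b)

  child-⊏ : ∀ {x b} → T (top x b) → x ↓ b ⊏ x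
  child-⊏ {x} {b} b∈x = return (b , b∈x , ⊑-refl {x ↓ b})

  -- Induction on the nodes of `x`. If some child `b` of `x` is not below `y`, no child of `y` can
  -- dominate `b`, so each one ranks below `b`, and `y` is at most `b`.
  ⊑-or-⊐ : ∀ x y → ¬ ¬ (x ⊑ y ⊎ y ⊏ x)
  ⊑-or-⊐ x = step x λ b _ →
      holds (wf x P (λ a ih → truth (return (step (x ↓ a) λ b b∈ → holds (ih b b∈)))) b)
    where
    P : A → Bool
    P a = ⟪ (∀ y → ¬ ¬ (x ↓ a ⊑ y ⊎ y ⊏ x ↓ a)) ⟫
    step : ∀ x → (∀ b → T (top x b) → ¬ ¬ (∀ y → ¬ ¬ (x ↓ b ⊑ y ⊎ y ⊏ x ↓ b))) →
           ∀ y → ¬ ¬ (x ⊑ y ⊎ y ⊏ x)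
    step x ih y = em (∃ λ b → T (top x b) × ¬ x ↓ b ⊏ y) >>= λ where
      (no none) → return (inj₁ (⊑-fold {x} {y} λ b b∈x b⋢y → none (b , b∈x , λ b⊏y → b⊏y b⋢y)))
      (yes (b , b∈x , b⊀y)) → return (inj₂ (return (b , b∈x , ⊑-fold {y} {x ↓ b} λ b′ b′∈y →
        ih b b∈x >>= λ compare → compare (y ↓ b′) >>= λ where
        (inj₁ b⊑b′) → contradiction (return (b′ , b′∈y , b⊑b′)) b⊀y
        (inj₂ b′⊏b) → b′⊏b)))

  -- Reduced to the well-foundedness of the relation inside `x`: the predicate on a node speaks of
  -- all ranks up to that of the node.
  ⊏-induction : (P : Rank → Bool) →
    (∀ x → (∀ y → y ⊏ x → T (P y)) → T (P x)) → ∀ x → T (P x)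
  ⊏-induction P progressive x = progressive x λ y y⊏x → T-stable do
    b , b∈x , y⊑b ← y⊏x
    below ← holds (wf x Q step b)
    return (below y y⊑b)
    where
    Q : A → Bool
    Q a = ⟪ (∀ y → y ⊑ x ↓ a → T (P y)) ⟫
    step : ∀ a → (∀ b → T (rel x b a) → T (Q b)) → T (Q a)
    step a ih = truth (return λ y y⊑a → progressive y λ z z⊏y → T-stable do
      b , b<a , z⊑b ← ⊏-⊑-trans {z} {y} {x ↓ a} z⊏y y⊑a
      below ← holds (ih b b<a)
      return (below z z⊑b))

  ⊏-asym : ∀ {x y} → x ⊏ y → ¬ y ⊏ x
  ⊏-asym {x} {y} x⊏y y⊏x = holds (⊏-induction P step x) λ f → f y x⊏y y⊏x
    where
    P : Rank → Bool
    P x = ⟪ (∀ y → x ⊏ y → ¬ y ⊏ x) ⟫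
    step : ∀ x → (∀ y → y ⊏ x → T (P y)) → T (P x)
    step x ih = truth (return λ y x⊏y y⊏x → holds (ih y y⊏x) λ f → f x y⊏x x⊏y)

  rankOrder : WellOrder Rank
  rankOrder = record
    { _<_       = λ x y → ⟪ x ⊏ y ⟫
    ; cotrans   = λ {x} {z} → cotrans {x} {z}
    ; asym      = λ {x} {y} x<y y<x → holds x<y λ p → holds y<x λ q → ⊏-asym {x} {y} p q
    ; induction = λ P prog → ⊏-induction P λ x ih → prog x λ y y<x → T-stable (holds y<x >>= λ p → return (ih y p))
    }
    where
    cotrans : ∀ {x z} y → T ⟪ x ⊏ z ⟫ → T ⟪ x ⊏ y ⟫ ⊎ T ⟪ y ⊏ z ⟫
    cotrans {x} {z} y x<z with T? ⟪ x ⊏ y ⟫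
    ... | yes x<y = inj₁ x<y
    ... | no  x≮y = inj₂ (truth do
      x⊏z ← holds x<z
      ⊑-or-⊐ y x >>= λ where
        (inj₁ y⊑x) → return (⊑-⊏-trans {y} {x} {z} y⊑x x⊏z)
        (inj₂ x⊏y) → contradiction (truth (return x⊏y)) x≮y)

  -- An injection would carry the order of the ranks over to a well-founded relation `R` on `A`. The
  -- rank `all` above all its nodes then exceeds every rank, itself included.
  no-injection : (E : Rank → A → Bool) → (∀ x → ∃ᶜ λ a → T (E x a)) →
                 ¬ (∀ {x y a} → T (E x a) → T (E y a) → ¬ x ⊏ y)
  no-injection E total inj = ⊏-asym {all} {all} (below all) (below all)
    where
    R : A → A → Bool
    R a b = ⟪ (∃₂ λ x y → T (E x a) × T (E y b) × x ⊏ y) ⟫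
    R-wf : WellFounded R
    R-wf P prog a = prog a λ b b<a → T-stable do
      x , _ , Exb , _ ← holds b<a
      f ← holds (⊏-induction Q step x)
      return (f b Exb)
      where
      Q : Rank → Bool
      Q x = ⟪ (∀ a → T (E x a) → T (P a)) ⟫
      step : ∀ x → (∀ y → y ⊏ x → T (Q y)) → T (Q x)
      step x ih = truth (return λ a Exa → prog a λ b b<a → T-stable do
        x′ , y′ , Ex′b , Ey′a , x′⊏y′ ← holds b<a
        -- The element `a` is a value at both `x` and `y′`, so `inj` excludes `x ⊏ y′`, and `x′`
        -- lies below `x`.
        f ← ⊑-or-⊐ y′ x >>= λ where
          (inj₁ y′⊑x) → holds (ih x′ (⊏-⊑-trans {x′} {y′} {x} x′⊏y′ y′⊑x))
          (inj₂ x⊏y′) → contradiction x⊏y′ (inj Exa Ey′a)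
        return (f b Ex′b))
    all : Rank
    all = record { rel = R ; wf = R-wf ; top = λ _ → true }
    below : ∀ x → x ⊏ all
    below x = do
      a , Exa ← total x
      return (a , _ , return (S , sim , λ b b∈x → do
        d , Ed ← total (x ↓ b)
        return (d , truth (return (x ↓ b , x , Ed , Exa , child-⊏ {x} b∈x)) , Ed)))
      where
      S : A → A → Bool
      S c d = E (x ↓ c) d
      sim : ∀ c d → T (S c d) → (λ d′ → R d′ d) Simulates[ S ] (λ b → rel x b c)
      sim c d Ecd b b<c = do
        d′ , Ed′ ← total (x ↓ b)
        return (d′ , truth (return (x ↓ b , x ↓ c , Ed′ , Ecd , child-⊏ {x ↓ c} b<c)) , Ed′)

-- Lexicographic comparison in Booleans; well-orders of pairs and of lists.

≡-stable : ∀ {x y : Bool} → ¬ ¬ (x ≡ y) → x ≡ y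
≡-stable {x} {y} = decidable-stable (x ≟ y)

-- Here `p` and `q` say that the first component is smaller or greater, `r` that the second is
-- smaller. A tie is the failure of both `p` and `q`.
lex : Bool → Bool → Bool → Bool
lex p q r = p ∨ not q ∧ r

lex⁺ˡ : ∀ p q r → T p → T (lex p q r)
lex⁺ˡ true _ _ _ = _

lex⁺ʳ : ∀ p q r → ¬ T q → T r → T (lex p q r)
lex⁺ʳ true  _     _    _  _ = _
lex⁺ʳ false false true _  _ = _
lex⁺ʳ false true  _    ¬q _ = ¬q _

lex⁻ : ∀ p q r → T (lex p q r) → T p ⊎ (¬ T q × T r)
lex⁻ true  _     _    _ = inj₁ _
lex⁻ false false true _ = inj₂ (id , _)

module _ {p₁₂ p₂₁ p₁₃ p₃₁ p₂₃ p₃₂ q₁₂ q₁₃ q₂₃ : Bool} where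

  -- When the first components decide neither `12` nor `23`, the cyclic instances `c₂` and `c₃`
  -- exclude the reverse comparisons as well, so the second components decide.
  lex-cotrans : (T p₁₃ → T p₁₂ ⊎ T p₂₃) → (T p₂₁ → T p₂₃ ⊎ T p₃₁) → (T p₃₂ → T p₃₁ ⊎ T p₁₂) →
                (T q₁₃ → T q₁₂ ⊎ T q₂₃) →
                T (lex p₁₃ p₃₁ q₁₃) → T (lex p₁₂ p₂₁ q₁₂) ⊎ T (lex p₂₃ p₃₂ q₂₃)
  lex-cotrans c₁ c₂ c₃ d l with lex⁻ p₁₃ p₃₁ q₁₃ l | T? p₁₂ | T? p₂₃
  ... | _ | yes t₁₂ | _ = inj₁ (lex⁺ˡ p₁₂ p₂₁ q₁₂ t₁₂)
  ... | _ | no _ | yes t₂₃ = inj₂ (lex⁺ˡ p₂₃ p₃₂ q₂₃ t₂₃)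
  ... | inj₁ t₁₃ | no f₁₂ | no f₂₃ with c₁ t₁₃
  ...   | inj₁ t₁₂ = contradiction t₁₂ f₁₂
  ...   | inj₂ t₂₃ = contradiction t₂₃ f₂₃
  lex-cotrans c₁ c₂ c₃ d l | inj₂ (f₃₁ , u₁₃) | no f₁₂ | no f₂₃ with d u₁₃
  ... | inj₁ u₁₂ = inj₁ (lex⁺ʳ p₁₂ p₂₁ q₁₂ (λ t₂₁ → neither (c₂ t₂₁)) u₁₂)
    where
    neither : ¬ (T p₂₃ ⊎ T p₃₁)
    neither (inj₁ t) = f₂₃ t
    neither (inj₂ t) = f₃₁ t
  ... | inj₂ u₂₃ = inj₂ (lex⁺ʳ p₂₃ p₃₂ q₂₃ (λ t₃₂ → neither (c₃ t₃₂)) u₂₃)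
    where
    neither : ¬ (T p₃₁ ⊎ T p₁₂)
    neither (inj₁ t) = f₃₁ t
    neither (inj₂ t) = f₁₂ t

lex-asym : ∀ {p q r s} → (T p → ¬ T q) → (T r → ¬ T s) → T (lex p q r) → ¬ T (lex q p s)
lex-asym {p} {q} {r} {s} pq rs l l′ with lex⁻ p q r l | lex⁻ q p s l′
... | inj₁ t | inj₁ u = pq t u
... | inj₁ t | inj₂ (¬t , _) = ¬t t
... | inj₂ (¬u , _) | inj₁ u = ¬u u
... | inj₂ (_ , t) | inj₂ (_ , u) = rs t u

module _ (lem : ClassicalLogic ℓ) {J : Set ℓ} {Y Z : Set ℓ} (V : WellOrder Y) (W : WellOrder Z)
         (f : J → Y) (g : J → Z) where
  open Comprehension lem
  private
    module V = WellOrder V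
    module W = WellOrder W

  -- Induction on the `f`-value, and inside it on the `g`-value. Both predicates range over all
  -- elements tied with the given value, since ties are not equalities.
  lexOrder : WellOrder J
  lexOrder = record
    { _<_       = _<_
    ; cotrans   = λ {s} {u} t → lex-cotrans (V.cotrans (f t)) (V.cotrans (f u)) (V.cotrans (f s)) (W.cotrans (g t))
    ; asym      = lex-asym V.asym W.asym
    ; induction = induction
    }
    where
    _<_ : J → J → Bool
    s < t = lex (f s V.< f t) (f t V.< f s) (g s W.< g t)
    induction : (P : J → Bool) → (∀ s → (∀ t → T (t < s) → T (P t)) → T (P s)) → ∀ s → T (P s)
    induction P prog s = T-stable (holds (V.induction Q Q-prog (f s)) >>= λ h → return (h s V.∼-refl))
      where
      Q : Y → Bool
      Q y = ⟪ (∀ s → f s V.∼ y → T (P s)) ⟫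
      Q-prog : ∀ y → (∀ y′ → T (y′ V.< y) → T (Q y′)) → T (Q y)
      Q-prog y ih = truth (return λ s fs∼y →
          T-stable (holds (W.induction R R-prog (g s)) >>= λ h → return (h s W.∼-refl fs∼y)))
        where
        R : Z → Bool
        R z = ⟪ (∀ s → g s W.∼ z → f s V.∼ y → T (P s)) ⟫
        R-prog : ∀ z → (∀ z′ → T (z′ W.< z) → T (R z′)) → T (R z)
        R-prog z ihz = truth (return λ s gs∼z fs∼y → prog s λ t t<s →
            T-stable (case s t gs∼z fs∼y (lex⁻ (f t V.< f s) (f s V.< f t) _ t<s)))
          where
          case : ∀ s t → g s W.∼ z → f s V.∼ y →
                 T (f t V.< f s) ⊎ (f s V.≮ f t × T (g t W.< g s)) → ¬ ¬ T (P t)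
          case s t gs∼z fs∼y (inj₁ ft<fs) = do
            h ← holds (ih (f t) (V.<-≮-trans ft<fs (proj₂ fs∼y)))
            return (h t V.∼-refl)
          case s t gs∼z fs∼y (inj₂ (fs≮ft , gt<gs)) = em (T (f t V.< f s)) >>= λ where
            (yes ft<fs) → case s t gs∼z fs∼y (inj₁ ft<fs)
            (no  ft≮fs) → do
              h ← holds (ihz (g t) (W.<-≮-trans gt<gs (proj₂ gs∼z)))
              return (h t W.∼-refl (V.∼-trans (ft≮fs , fs≮ft) fs∼y))

module _ (lem : ClassicalLogic ℓ) {X : Set ℓ} (W : WellOrder X) where
  open Comprehension lem
  private module W = WellOrder W

  -- The tails are compared first, so that well-foundedness follows by recursion
  -- on the list.
  colexOrder : WellOrder (List X)
  colexOrder = record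
    { _<_       = _<_
    ; cotrans   = λ {xs} {zs} ys → cotrans xs ys zs
    ; asym      = λ {xs} {ys} → asym xs ys
    ; induction = induction
    }
    where
    _<_ : List X → List X → Bool
    _        < []       = false
    []       < (_ ∷ _)  = true
    (x ∷ xs) < (y ∷ ys) = lex (xs < ys) (ys < xs) (x W.< y)

    cotrans : ∀ xs ys zs → T (xs < zs) → T (xs < ys) ⊎ T (ys < zs)
    cotrans [] [] (z ∷ zs) l = inj₂ _
    cotrans [] (y ∷ ys) (z ∷ zs) l = inj₁ _
    cotrans (x ∷ xs) [] (z ∷ zs) l = inj₂ _
    cotrans (x ∷ xs) (y ∷ ys) (z ∷ zs) =
      lex-cotrans (cotrans xs ys zs) (cotrans ys zs xs) (cotrans zs xs ys) (W.cotrans y)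

    asym : ∀ xs ys → T (xs < ys) → ¬ T (ys < xs)
    asym (x ∷ xs) (y ∷ ys) = lex-asym (asym xs ys) W.asym

    irrefl : ∀ xs → ¬ T (xs < xs)
    irrefl xs l = asym xs xs l l

    _∼_ : List X → List X → Set
    xs ∼ ys = ¬ T (xs < ys) × ¬ T (ys < xs)

    Progressive : (List X → Bool) → Set ℓ
    Progressive P = ∀ xs → (∀ ys → T (ys < xs) → T (P ys)) → T (P xs)

    <-∼-trans : ∀ {xs ys zs} → T (xs < ys) → ys ∼ zs → T (xs < zs)
    <-∼-trans {xs} {ys} {zs} l (_ , zs≮ys) with cotrans xs zs ys l
    ... | inj₁ t = t
    ... | inj₂ t = contradiction t zs≮ys

    ∼-trans : ∀ {xs ys zs} → xs ∼ ys → ys ∼ zs → xs ∼ zs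
    ∼-trans {xs} {ys} {zs} (p , q) (r , s) =
        (λ l → either p r (cotrans xs ys zs l)) , λ l → either s q (cotrans zs ys xs l)
      where
      either : ∀ {u v} → ¬ T u → ¬ T v → ¬ (T u ⊎ T v)
      either ¬u ¬v (inj₁ u) = ¬u u
      either ¬u ¬v (inj₂ v) = ¬v v

    Heads : (List X → Bool) → List X → Bool
    Heads P xs = ⟪ (∀ x → T (P (x ∷ xs))) ⟫

    -- An inner induction on the head: a predecessor with a smaller tail is covered for every head
    -- by `ih`, and one with a tied tail has a smaller head.
    heads-progressive : ∀ P → Progressive P → Progressive (Heads P)
    heads-progressive P prog xs ih = truth (return λ x →
        T-stable (holds (W.induction Q Q-prog x) >>= λ h → return (h xs (irrefl xs , irrefl xs))))
      where
      Q : X → Bool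
      Q x = ⟪ (∀ ys → ys ∼ xs → T (P (x ∷ ys))) ⟫
      Q-prog : ∀ x → (∀ y → T (y W.< x) → T (Q y)) → T (Q x)
      Q-prog x ihx = truth (return λ ys ys∼xs → prog (x ∷ ys) λ where
        []       _ → prog [] λ _ ()
        (z ∷ zs) l → T-stable (case z zs ys ys∼xs (lex⁻ (zs < ys) (ys < zs) _ l)))
        where
        case : ∀ z zs ys → ys ∼ xs → T (zs < ys) ⊎ (¬ T (ys < zs) × T (z W.< x)) → ¬ ¬ T (P (z ∷ zs))
        case z zs ys ys∼xs (inj₁ zs<ys) = do
          h ← holds (ih zs (<-∼-trans {zs} {ys} {xs} zs<ys ys∼xs))
          return (h z)
        case z zs ys ys∼xs (inj₂ (ys≮zs , z<x)) = em (T (zs < ys)) >>= λ where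
          (yes zs<ys) → case z zs ys ys∼xs (inj₁ zs<ys)
          (no  zs≮ys) → do
            h ← holds (ihx z z<x)
            return (h zs (∼-trans {zs} {ys} {xs} (zs≮ys , ys≮zs) ys∼xs))

    induction : ∀ P → Progressive P → ∀ xs → T (P xs)
    induction P prog []       = prog [] λ _ ()
    induction P prog (x ∷ xs) =
      T-stable (holds (induction (Heads P) (heads-progressive P prog) xs) >>= λ h → return (h x))

  private module L = WellOrder colexOrder

  Pointwise⇒∼ : ∀ {xs ys} → Pointwise W._∼_ xs ys → xs L.∼ ys
  Pointwise⇒∼ [] = L.∼-refl {[]}
  Pointwise⇒∼ {x ∷ xs} {y ∷ ys} ((x≮y , y≮x) ∷ ps) with Pointwise⇒∼ ps
  ... | xs≮ys , ys≮xs = absurd xs≮ys x≮y , absurd ys≮xs y≮x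
    where
    absurd : ∀ {p q r} → ¬ T p → ¬ T r → ¬ T (lex p q r)
    absurd {p} {q} {r} ¬p ¬r l with lex⁻ p q r l
    ... | inj₁ t = ¬p t
    ... | inj₂ (_ , t) = ¬r t

  ∼⇒Pointwise : ∀ {xs ys} → xs L.∼ ys → Pointwise W._∼_ xs ys
  ∼⇒Pointwise {[]} {[]} _ = []
  ∼⇒Pointwise {[]} {y ∷ ys} (p , _) = contradiction _ p
  ∼⇒Pointwise {x ∷ xs} {[]} (_ , p) = contradiction _ p
  ∼⇒Pointwise {x ∷ xs} {y ∷ ys} (p , q) =
    (p ∘ lex⁺ʳ (xs L.< ys) (ys L.< xs) (x W.< y) ys≮xs , q ∘ lex⁺ʳ (ys L.< xs) (xs L.< ys) (y W.< x) xs≮ys)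
      ∷ ∼⇒Pointwise (xs≮ys , ys≮xs)
    where
    xs≮ys : xs L.≮ ys
    xs≮ys l = p (lex⁺ˡ (xs L.< ys) (ys L.< xs) (x W.< y) l)
    ys≮xs : ys L.≮ xs
    ys≮xs l = q (lex⁺ˡ (ys L.< xs) (xs L.< ys) (y W.< x) l)

-- Transfinite recursion for relations.

module Recursion (lem : ClassicalLogic ℓ) {J A : Set ℓ} (W : WellOrder J)
                 (V : (J → A → Bool) → J → A → Bool)
                 (local : ∀ {E E′} s → (∀ t → T (WellOrder._<_ W t s) → ∀ a → E t a ≡ E′ t a) →
                          ∀ a → V E s a ≡ V E′ s a) where
  open Comprehension lem
  open WellOrder W

  private
    ApproxBelow Approx : (J → A → Bool) → J → Set ℓ
    ApproxBelow E s = ∀ t → T (t < s) → ∀ a → E t a ≡ V E t a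
    Approx E s = ApproxBelow E s × (∀ a → E s a ≡ V E s a)

    restrict : ∀ {E s t} → ApproxBelow E s → T (t < s) → Approx E t
    restrict ap t<s = (λ u u<t → ap u (<-trans u<t t<s)) , ap _ t<s

    unique : ∀ {E E′} s → Approx E s → Approx E′ s → ∀ a → E s a ≡ E′ s a
    unique {E} {E′} s (below , at) (below′ , at′) a =
      trans (at a) (trans (local s agree a) (sym (at′ a)))
      where
      P : J → Bool
      P t = ⟪ (T (t < s) → ∀ a → E t a ≡ E′ t a) ⟫
      step : ∀ t → (∀ u → T (u < t) → T (P u)) → T (P t)
      step t ih = truth (return λ t<s a →
        trans (below t t<s a) (trans (local t (earlier t<s) a) (sym (below′ t t<s a))))
        where
        earlier : T (t < s) → ∀ u → T (u < t) → ∀ a → E u a ≡ E′ u a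
        earlier t<s u u<t a = ≡-stable (holds (ih u u<t) >>= λ h → return (h (<-trans u<t t<s) a))
      agree : ∀ t → T (t < s) → ∀ a → E t a ≡ E′ t a
      agree t t<s a = ≡-stable (holds (induction P step t) >>= λ h → return (h t<s a))

  abstract
    -- The union of all approximations defined up to `s`, which agree by `unique`. The result is a
    -- graph because values exist only classically.
    fix : J → A → Bool
    fix s a = ⟪ (∃ λ E → Approx E s × T (E s a)) ⟫

    fix-unfold : ∀ s a → fix s a ≡ V fix s a
    fix-unfold s a = ≡-stable (holds (induction P step s) >>= λ h → return (h a))
      where
      P : J → Bool
      P t = ⟪ (∀ a → fix t a ≡ V fix t a) ⟫
      step : ∀ s → (∀ t → T (t < s) → T (P t)) → T (P s)
      step s ih = truth (return λ a → T⇒≡ (to a) (from a))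
        where
        below : ApproxBelow fix s
        below t t<s a = ≡-stable (holds (ih t t<s) >>= λ h → return (h a))
        -- One application of V to fix is an approximation at s itself.
        approx : Approx (V fix) s
        approx = (λ t t<s a → local t (λ u u<t → below u (<-trans u<t t<s)) a) , local s below
        to : ∀ a → T (fix s a) → T (V fix s a)
        to a f = T-stable do
          E , ap , Esa ← holds f
          let agree : ∀ t → T (t < s) → ∀ a → E t a ≡ fix t a
              agree t t<s a = T⇒≡ (λ Eta → truth (return (E , restrict (proj₁ ap) t<s , Eta)))
                (λ f → T-stable do
                   E′ , ap′ , E′ta ← holds f
                   return (subst T (unique t ap′ (restrict (proj₁ ap) t<s) a) E′ta))
          return (subst T (trans (proj₂ ap a) (local s agree a)) Esa)
        from : ∀ a → T (V fix s a) → T (fix s a)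
        from a v = truth (return (V fix , approx , v))

-- Words over a well-order with two bits, and codes for sequences of words.

lex⁻-∼ : ∀ p q r r′ → ¬ T (lex p q r) → ¬ T (lex q p r′) → (¬ T p × ¬ T q) × (¬ T r × ¬ T r′)
lex⁻-∼ p q r r′ f g = (¬p , ¬q) , ((f ∘ lex⁺ʳ p q r ¬q) , (g ∘ lex⁺ʳ q p r′ ¬p))
  where
  ¬p = f ∘ lex⁺ˡ p q r
  ¬q = g ∘ lex⁺ˡ q p r′

lex⁺-∼ : ∀ p q r r′ → ¬ T p × ¬ T q → ¬ T r × ¬ T r′ → ¬ T (lex p q r) × ¬ T (lex q p r′)
lex⁺-∼ p q r r′ (¬p , ¬q) (¬r , ¬r′) =
  ([ ¬p , ¬r ∘ proj₂ ]′ ∘ lex⁻ p q r) , ([ ¬q , ¬r′ ∘ proj₂ ]′ ∘ lex⁻ q p r′)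

if-elim : {A : Set a} (P : A → Set b) {x y : A} (t : Bool) →
          (T t → P x) → (¬ T t → P y) → P (if t then x else y)
if-elim P true  f _ = f _
if-elim P false _ g = g id

module Words (lem : ClassicalLogic ℓ) {X : Set ℓ} (W : WellOrder X) where
  private module W = WellOrder W

  data Symbol : Set ℓ where
    bit : Bool → Symbol
    ord : X → Symbol

  symbolOrder : WellOrder Symbol
  symbolOrder = record
    { _<_       = _<_
    ; cotrans   = λ {x} {z} y → cotrans x y z
    ; asym      = λ {x} {y} → asym x y
    ; induction = induction
    }
    where
    _<_ : Symbol → Symbol → Bool
    bit a < bit b = not a ∧ b
    bit _ < ord _ = true
    ord _ < bit _ = false
    ord x < ord y = x W.< y
    cotrans : ∀ x y z → T (x < z) → T (x < y) ⊎ T (y < z)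
    cotrans (bit false) (bit false) (bit true) _ = inj₂ _
    cotrans (bit false) (bit true)  (bit true) _ = inj₁ _
    cotrans (bit false) (ord _)     (bit true) _ = inj₁ _
    cotrans (bit _)     (bit _)     (ord _)    _ = inj₂ _
    cotrans (bit _)     (ord _)     (ord _)    _ = inj₁ _
    cotrans (ord _)     (bit _)     (ord _)    _ = inj₂ _
    cotrans (ord _)     (ord y)     (ord _)    l = W.cotrans y l
    asym : ∀ x y → T (x < y) → ¬ T (y < x)
    asym (bit false) (bit true) _ ()
    asym (bit _)     (ord _)    _ ()
    asym (ord _)     (ord _)      = W.asym
    induction : (P : Symbol → Bool) → (∀ x → (∀ y → T (y < x) → T (P y)) → T (P x)) → ∀ x → T (P x)
    induction P prog = λ where
        (bit b) → bits b
        (ord x) → W.induction (P ∘ ord) (λ x ih → prog (ord x) λ where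
          (bit b) _   → bits b
          (ord y) y<x → ih y y<x) x
      where
      bit-false : T (P (bit false))
      bit-false = prog (bit false) λ where
        (bit false) ()
        (bit true)  ()
        (ord _)     ()
      bits : ∀ b → T (P (bit b))
      bits false = bit-false
      bits true  = prog (bit true) λ where
        (bit false) _ → bit-false
        (bit true)  ()
        (ord _)     ()

  private module S = WellOrder symbolOrder

  Word : Set ℓ
  Word = List Symbol

  maxSymbol : Word → Symbol
  -- The least symbol, so that the end of a word does not affect the maximum.
  maxSymbol []       = bit false
  maxSymbol (x ∷ xs) = if maxSymbol xs S.< x then x else maxSymbol xs

  -- With the largest symbol compared first, a word with largest symbol above `bit false` is
  -- preceded by all words over the smaller symbols, however long. This leaves room for the codes.
  wordOrder : WellOrder Word
  wordOrder = lexOrder lem symbolOrder (colexOrder lem symbolOrder) maxSymbol id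

  private
    module C = WellOrder (colexOrder lem symbolOrder)
    module J = WellOrder wordOrder

  maxSymbol-upper : ∀ xs → All (λ y → maxSymbol xs S.≮ y) xs
  maxSymbol-upper [] = []
  maxSymbol-upper (x ∷ xs) = if-elim (λ m → All (λ y → m S.≮ y) (x ∷ xs)) (maxSymbol xs S.< x)
    (λ m<x → S.irrefl {x} ∷ All.map (λ m≮y x<y → m≮y (S.<-trans {maxSymbol xs} {x} m<x x<y)) (maxSymbol-upper xs))
    (λ m≮x → m≮x ∷ maxSymbol-upper xs)

  maxSymbol-lub : ∀ {z} xs → T (bit false S.< z) → All (λ y → T (y S.< z)) xs → T (maxSymbol xs S.< z)
  maxSymbol-lub [] b<z [] = b<z
  maxSymbol-lub (x ∷ xs) b<z (x<z ∷ ps) with maxSymbol xs S.< x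
  ... | true  = x<z
  ... | false = maxSymbol-lub xs b<z ps

  -- Thus a symbol of a predecessor of `s` is either below the largest symbol of `s` or tied with
  -- it, as decoding requires.
  words-below : ∀ {s t} → T (t J.< s) → All (λ y → maxSymbol s S.≮ y) t
  words-below {s} {t} t<s = All.map (S.≮-trans {maxSymbol s} {maxSymbol t} ms≮mt) (maxSymbol-upper t)
    where
    ms≮mt : maxSymbol s S.≮ maxSymbol t
    ms≮mt = [ S.asym {maxSymbol t} {maxSymbol s} , proj₁ ]′
            (lex⁻ (maxSymbol t S.< maxSymbol s) (maxSymbol s S.< maxSymbol t) (t C.< s) t<s)

  small-words : ∀ {s v} → T (bit false S.< maxSymbol s) → All (λ y → T (y S.< maxSymbol s)) v → T (v J.< s)
  small-words {s} {v} b<m ps =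
    lex⁺ˡ (maxSymbol v S.< maxSymbol s) (maxSymbol s S.< maxSymbol v) (v C.< s) (maxSymbol-lub v b<m ps)

  ∼⇒Pointwise-words : ∀ {s t} → s J.∼ t → Pointwise S._∼_ s t
  ∼⇒Pointwise-words {s} {t} (p , q) = ∼⇒Pointwise lem symbolOrder
    (proj₂ (lex⁻-∼ (maxSymbol s S.< maxSymbol t) (maxSymbol t S.< maxSymbol s) _ _ p q))

  ∼⇒∼-max : ∀ {s t} → s J.∼ t → maxSymbol s S.∼ maxSymbol t
  ∼⇒∼-max {s} {t} (p , q) =
    proj₁ (lex⁻-∼ (maxSymbol s S.< maxSymbol t) (maxSymbol t S.< maxSymbol s) (s C.< t) (t C.< s) p q)

  private
    maxSymbol-cong : ∀ {s t} → Pointwise S._∼_ s t → maxSymbol s S.∼ maxSymbol t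
    maxSymbol-cong [] = S.∼-refl {bit false}
    maxSymbol-cong {x ∷ s} {y ∷ t} ((x≮y , y≮x) ∷ ps) with maxSymbol-cong ps
    ... | ms≮mt , mt≮ms = if-elim (λ m → m S.∼ maxSymbol (y ∷ t)) (maxSymbol s S.< x)
      (λ ms<x → if-elim (λ m → x S.∼ m) (maxSymbol t S.< y)
        (λ _    → x≮y , y≮x)
        (λ mt≮y → contradiction
          (S.≮-<-trans {maxSymbol t} {maxSymbol s} ms≮mt (S.<-≮-trans {maxSymbol s} {x} {y} ms<x y≮x)) mt≮y))
      (λ ms≮x → if-elim (λ m → maxSymbol s S.∼ m) (maxSymbol t S.< y)
        (λ mt<y → contradiction
          (S.≮-<-trans {maxSymbol s} {maxSymbol t} mt≮ms (S.<-≮-trans {maxSymbol t} {y} {x} mt<y x≮y)) ms≮x)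
        (λ _    → ms≮mt , mt≮ms))

  Pointwise⇒∼-words : ∀ {s t} → Pointwise S._∼_ s t → s J.∼ t
  Pointwise⇒∼-words {s} {t} ps =
    lex⁺-∼ (maxSymbol s S.< maxSymbol t) (maxSymbol t S.< maxSymbol s) (s C.< t) (t C.< s)
      (maxSymbol-cong ps) (Pointwise⇒∼ lem symbolOrder ps)

  -- A prefix code: 0y stands for a small symbol y, 10 for any other symbol and
  -- 11 for the end of a word.
  code : (Symbol → Bool) → List Word → Word
  code small []               = []
  code small ([] ∷ ws)        = bit true ∷ bit true ∷ code small ws
  code small ((y ∷ w) ∷ ws)   = if small y then bit false ∷ y ∷ code small (w ∷ ws)
                                else bit true ∷ bit false ∷ code small (w ∷ ws)

  code-cong : ∀ {small small′} → (∀ y → small y ≡ small′ y) → ∀ ws → code small ws ≡ code small′ ws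
  code-cong eq [] = refl
  code-cong eq ([] ∷ ws) = cong (λ v → bit true ∷ bit true ∷ v) (code-cong eq ws)
  code-cong {small} {small′} eq ((y ∷ w) ∷ ws) = cong₂ step (eq y) (code-cong eq (w ∷ ws))
    where
    step : Bool → Word → Word
    step b v = if b then bit false ∷ y ∷ v else bit true ∷ bit false ∷ v

  code-small : ∀ {small} → (∀ b → T (small (bit b))) → ∀ ws → All (T ∘ small) (code small ws)
  code-small bits [] = []
  code-small bits ([] ∷ ws) = bits true ∷ bits true ∷ code-small bits ws
  code-small {small} bits ((y ∷ w) ∷ ws) = if-elim (All (T ∘ small)) (small y)
    (λ y-small → bits false ∷ y-small ∷ code-small bits (w ∷ ws))
    (λ _       → bits true ∷ bits false ∷ code-small bits (w ∷ ws))

  bits-differ : ¬ (bit false S.∼ bit true) × ¬ (bit true S.∼ bit false)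
  bits-differ = (λ (p , _) → p _) , (λ (_ , p) → p _)

  -- The code forgets which large symbol it replaces; `Admissible` says that, up to ties, `m` is the
  -- only one. The signs are then read off from the left.
  code-injective : ∀ {small m} ws ws′ →
    let Admissible = λ y → ¬ T (small y) → y S.∼ m in
    All (All Admissible) ws → All (All Admissible) ws′ →
    Pointwise S._∼_ (code small ws) (code small ws′) → Pointwise (Pointwise S._∼_) ws ws′
  code-injective [] [] _ _ _ = []
  code-injective {small} [] ((y ∷ w) ∷ ws) _ _ ps with small y
  code-injective {small} [] ((y ∷ w) ∷ ws) _ _ () | true
  code-injective {small} [] ((y ∷ w) ∷ ws) _ _ () | false
  code-injective {small} ((y ∷ w) ∷ ws) [] _ _ ps with small y
  code-injective {small} ((y ∷ w) ∷ ws) [] _ _ () | true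
  code-injective {small} ((y ∷ w) ∷ ws) [] _ _ () | false
  code-injective ([] ∷ ws) ([] ∷ ws′) (_ ∷ as) (_ ∷ as′) (_ ∷ _ ∷ ps) =
    [] ∷ code-injective ws ws′ as as′ ps
  code-injective {small} ([] ∷ ws) ((y ∷ w) ∷ ws′) _ _ ps with small y | ps
  ... | true  | p ∷ _     = contradiction p (proj₂ bits-differ)
  ... | false | _ ∷ p ∷ _ = contradiction p (proj₂ bits-differ)
  code-injective {small} ((y ∷ w) ∷ ws) ([] ∷ ws′) _ _ ps with small y | ps
  ... | true  | p ∷ _     = contradiction p (proj₁ bits-differ)
  ... | false | _ ∷ p ∷ _ = contradiction p (proj₁ bits-differ)
  code-injective {small} {m} ((y ∷ w) ∷ ws) ((y′ ∷ w′) ∷ ws′) ((a ∷ as) ∷ ass) ((a′ ∷ as′) ∷ ass′) ps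
    with small y | small y′ | ps
  ... | true  | false | p ∷ _ = contradiction p (proj₁ bits-differ)
  ... | false | true  | p ∷ _ = contradiction p (proj₂ bits-differ)
  ... | true  | true  | _ ∷ p ∷ ps′
    with code-injective (w ∷ ws) (w′ ∷ ws′) (as ∷ ass) (as′ ∷ ass′) ps′
  ...   | q ∷ qs = (p ∷ q) ∷ qs
  code-injective {small} {m} ((y ∷ w) ∷ ws) ((y′ ∷ w′) ∷ ws′) ((a ∷ as) ∷ ass) ((a′ ∷ as′) ∷ ass′) ps
      | false | false | _ ∷ _ ∷ ps′
    with code-injective (w ∷ ws) (w′ ∷ ws′) (as ∷ ass) (as′ ∷ ass′) ps′
  ...   | q ∷ qs = (S.∼-trans {y} {m} {y′} (a id) (S.∼-sym {y′} {m} (a′ id)) ∷ q) ∷ qs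

  -- A bijective binary numeral on words of bits, junk on other words.
  number : Word → ℕ
  number []              = 0
  number (bit false ∷ w) = suc (number w + number w)
  number (bit true ∷ w)  = suc (suc (number w + number w))
  number (ord _ ∷ w)     = 0

  data IsBit : Symbol → Set ℓ where
    is-bit : ∀ b → IsBit (bit b)

  private
    double-injective : ∀ m n → m + m ≡ n + n → m ≡ n
    double-injective 0 0 _ = refl
    double-injective (suc m) (suc n) eq =
      cong suc (double-injective m n
        (ℕ.suc-injective (trans (sym (ℕ.+-suc m m)) (trans (ℕ.suc-injective eq) (ℕ.+-suc n n)))))

    parity : ∀ m n → suc (m + m) ≢ n + n
    parity 0 (suc n) eq with trans (ℕ.suc-injective eq) (ℕ.+-suc n n)
    ... | ()
    parity (suc m) (suc n) eq =
      parity m n (ℕ.suc-injective (trans (cong suc (sym (ℕ.+-suc m m))) (trans (ℕ.suc-injective eq) (ℕ.+-suc n n))))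

  number-injective : ∀ {v w} → All IsBit v → All IsBit w → number v ≡ number w → v ≡ w
  number-injective [] [] _ = refl
  number-injective [] (is-bit false ∷ _) ()
  number-injective [] (is-bit true ∷ _) ()
  number-injective (is-bit false ∷ _) [] ()
  number-injective (is-bit true ∷ _) [] ()
  number-injective {_ ∷ v} {_ ∷ w} (is-bit false ∷ p) (is-bit false ∷ q) eq =
    cong (bit false ∷_) (number-injective p q (double-injective (number v) (number w) (ℕ.suc-injective eq)))
  number-injective {_ ∷ v} {_ ∷ w} (is-bit true ∷ p) (is-bit true ∷ q) eq =
    cong (bit true ∷_) (number-injective p q
      (double-injective (number v) (number w) (ℕ.suc-injective (ℕ.suc-injective eq))))
  number-injective {_ ∷ v} {_ ∷ w} (is-bit false ∷ p) (is-bit true ∷ q) eq =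
    contradiction (sym (ℕ.suc-injective eq)) (parity (number w) (number v))
  number-injective {_ ∷ v} {_ ∷ w} (is-bit true ∷ p) (is-bit false ∷ q) eq =
    contradiction (ℕ.suc-injective eq) (parity (number v) (number w))

-- Finite choice, finitary equivalence relations and their encodings by sequences.

∨⁺ˡ : ∀ x y → T x → T (x ∨ y)
∨⁺ˡ true _ _ = _

∨⁺ʳ : ∀ x y → T y → T (x ∨ y)
∨⁺ʳ true  _ _ = _
∨⁺ʳ false _ t = t

∨⁻ : ∀ x y → T (x ∨ y) → T x ⊎ T y
∨⁻ true  _ _ = inj₁ _
∨⁻ false _ t = inj₂ t

-- Choice along a list is provable by induction on the list.
All-choice : {A : Set a} {B : Set b} {R : A → B → Set c} {xs : List A} →
             All (λ x → ∃ᶜ λ y → R x y) xs → ∃ᶜ λ ys → Pointwise R xs ys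
All-choice [] = return ([] , [])
All-choice (p ∷ ps) = do
  y , r ← p
  ys , rs ← All-choice ps
  return (y ∷ ys , r ∷ rs)

module Sets (A : Set ℓ) (_==_ : A → A → Bool) (==-isEquivalence : IsEquivalence (λ x y → T (x == y))) where

  module == = IsEquivalence ==-isEquivalence

  infix 4 _≋_
  _≋_ : List A → List A → Set ℓ
  _≋_ = Pointwise (λ x y → T (x == y))

  ≋-stable : ∀ {xs ys} → ¬ ¬ xs ≋ ys → xs ≋ ys
  ≋-stable = decidable-stable (Pw.decidable (λ x y → T? (x == y)) _ _)

  Respects : (A → Bool) → Set ℓ
  Respects P = ∀ {x y} → T (x == y) → T (P x) → T (P y)

  -- The graph of a partial choice: given as a predicate, the result is closed under `==`, and for
  -- `O` respecting `==` it depends on the sequence only up to `≋`.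
  firstOutside : (A → Bool) → List A → A → Bool
  firstOutside O []       a = false
  firstOutside O (x ∷ xs) a = if O x then firstOutside O xs a else a == x

  firstOutside-respects : ∀ {O} xs → Respects (firstOutside O xs)
  firstOutside-respects {O} (x ∷ xs) a=b with O x
  ... | true  = firstOutside-respects xs a=b
  ... | false = ==.trans (==.sym a=b)

  firstOutside-outside : ∀ {O} → Respects O → ∀ xs {a} → T (firstOutside O xs a) → ¬ T (O a)
  firstOutside-outside {O} resp (x ∷ xs) {a} h a∈O with O x in e
  ... | true  = firstOutside-outside resp xs h a∈O
  ... | false = subst T e (resp h a∈O)

  firstOutside-unique : ∀ {O} → Respects O → ∀ {xs ys a b} → xs ≋ ys →
                        T (firstOutside O xs a) → T (firstOutside O ys b) → T (a == b)
  firstOutside-unique {O} resp {x ∷ xs} {y ∷ ys} (x=y ∷ ps) h h′ with O x in e | O y in e′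
  ... | true  | true  = firstOutside-unique resp ps h h′
  ... | true  | false = ⊥-elim (subst T e′ (resp x=y (subst T (sym e) _)))
  ... | false | true  = ⊥-elim (subst T e (resp (==.sym x=y) (subst T (sym e′) _)))
  ... | false | false = ==.trans h (==.trans x=y (==.sym h′))

  firstOutside-exists : ∀ {O} xs → ¬ All (T ∘ O) xs → ∃ λ a → T (firstOutside O xs a)
  firstOutside-exists [] ¬all = contradiction [] ¬all
  firstOutside-exists {O} (x ∷ xs) ¬all with O x in e
  ... | true  = firstOutside-exists xs λ all → ¬all (subst T (sym e) _ ∷ all)
  ... | false = x , ==.refl

  firstOutside-cong : ∀ {O O′} → (∀ x → O x ≡ O′ x) → ∀ xs a → firstOutside O xs a ≡ firstOutside O′ xs a
  firstOutside-cong eq [] a = refl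
  firstOutside-cong {O} {O′} eq (x ∷ xs) a =
    cong₂ (λ b t → if b then t else a == x) (eq x) (firstOutside-cong eq xs a)

  -- A finitary partition in the guise of its equivalence relation, each class being covered by a
  -- finite list.
  record IsFinitary (r : A → A → Bool) : Set ℓ where
    field
      reflexive  : ∀ {x y} → T (x == y) → T (r x y)
      symmetric  : ∀ {x y} → T (r x y) → T (r y x)
      transitive : ∀ {x y z} → T (r x y) → T (r y z) → T (r x z)
      finite     : ∀ x → ∃ᶜ λ L → ∀ y → T (r x y) → Any (λ z → T (y == z)) L

  infix 4 _≐_
  _≐_ : (A → A → Bool) → (A → A → Bool) → Set ℓ
  r ≐ r′ = ∀ x y → r x y ≡ r′ x y

  -- The graph of an injection of the finitary partitions into the sequences of length at most `n`:
  -- the object to be refuted.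
  record IsEncoding (n : ℕ) (G : (A → A → Bool) → List A → Set ℓ) : Set ℓ where
    field
      total     : ∀ {r} → IsFinitary r → ∃ᶜ λ xs → G r xs
      bounded   : ∀ {r xs} → G r xs → length xs ≤ n
      respects  : ∀ {r r′ xs} → r ≐ r′ → G r xs → G r′ xs
      single    : ∀ {r xs ys} → G r xs → G r ys → xs ≋ ys
      injective : ∀ {r r′ xs ys} → xs ≋ ys → G r xs → G r′ ys → r ≐ r′

  module _ {J : Set ℓ} (W : WellOrder J) where
    open WellOrder W

    record IsInjectiveOn (D : J → Set) (E : J → A → Bool) : Set ℓ where
      field
        total     : ∀ {t} → D t → ∃ᶜ λ a → T (E t a)
        single    : ∀ {t a b} → D t → T (E t a) → T (E t b) → T (a == b)
        injective : ∀ {t u a} → D t → D u → T (E t a) → T (E u a) → t ∼ u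

    -- The induction common to the embeddings of ω and of the words: only the existence, uniqueness
    -- and novelty of the next value remain to be checked.
    module _ (lem : ClassicalLogic ℓ) (E : J → A → Bool)
             (next : ∀ s → IsInjectiveOn (λ t → T (t < s)) E →
                     (∃ᶜ λ a → T (E s a)) ×
                     (∀ {a b} → T (E s a) → T (E s b) → T (a == b)) ×
                     (∀ {t a} → T (t < s) → T (E t a) → ¬ T (E s a)))
             where
      open Comprehension lem

      private
        Good : J → Set ℓ
        Good s = (∃ᶜ λ a → T (E s a)) ×
                 (∀ {a b} → T (E s a) → T (E s b) → T (a == b)) ×
                 (∀ {t a} → T (t < s) → T (E t a) → ¬ T (E s a))

        fromGood : ∀ {D : J → Set} → (∀ {t} → D t → ¬ ¬ Good t) → IsInjectiveOn D E
        fromGood good = record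
          { total     = λ Dt → good Dt >>= proj₁
          ; single    = λ Dt Eta Etb → T-stable (good Dt >>= λ g → return (proj₁ (proj₂ g) Eta Etb))
          ; injective = λ Dt Du Eta Eua →
              (λ t<u → good Du λ g → proj₂ (proj₂ g) t<u Eta Eua) ,
              (λ u<t → good Dt λ g → proj₂ (proj₂ g) u<t Eua Eta)
          }

        good : ∀ s → ¬ ¬ Good s
        good s = holds (induction (λ s → ⟪ Good s ⟫)
          (λ s ih → truth (return (next s (fromGood λ t<s → holds (ih _ t<s))))) s)

      isInjective : ∀ {D} → IsInjectiveOn D E
      isInjective = fromGood λ {t} _ → good t

  -- The diagonal partition and the next value.

  module Diagonal (lem : ClassicalLogic ℓ) {X : Set ℓ} (W : WellOrder X)
                  {n} {G : (A → A → Bool) → List A → Set ℓ} (isEncoding : IsEncoding n G) where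
    open Comprehension lem
    open Words lem W
    private
      module S = WellOrder symbolOrder
      module J = WellOrder wordOrder
      module G = IsEncoding isEncoding

    -- w belongs to the diagonal set: it is the code of a sequence of old values
    -- that encodes a relation r, and r separates the pair of values indexed by w.
    record Refuted (E : Word → A → Bool) (old : Word → Bool) (small : Symbol → Bool) (w : Word) : Set ℓ where
      field
        word-small : All (T ∘ small) w
        {ws}       : List Word
        {r}        : A → A → Bool
        {xs}       : List A
        {x₀ x₁}    : A
        ws-old     : All (T ∘ old) ws
        coded      : code small ws ≡ w
        encoded    : G r xs
        listed     : Pointwise (λ w x → T (E w x)) ws xs
        value₀     : T (E (bit false ∷ w) x₀)
        value₁     : T (E (bit true ∷ w) x₁)
        separated  : ¬ T (r x₀ x₁)

    pair : (Word → A → Bool) → Word → A → Bool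
    pair E w x = E (bit false ∷ w) x ∨ E (bit true ∷ w) x

    -- Only words of the diagonal set contribute pairs; injectivity of `E` on old words keeps the
    -- pairs disjoint, so classes have at most two elements.
    glue : (Word → A → Bool) → (Word → Bool) → (Symbol → Bool) → A → A → Bool
    glue E old small x y =
      x == y ∨ ⟪ (∃ λ w → Refuted E old small w × T (pair E w x) × T (pair E w y)) ⟫

    values : (Word → A → Bool) → (Word → Bool) → A → Bool
    values E old x = ⟪ (∃ λ w → T (old w) × T (E w x)) ⟫

    diagonal : (Word → A → Bool) → (Word → Bool) → (Symbol → Bool) → A → Bool
    diagonal E old small a =
      ⟪ (∃ λ xs → G (glue E old small) xs × T (firstOutside (values E old) xs a)) ⟫

    -- The data on which `diagonal` depends. It serves twice: for locality of the recursion, where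
    -- `E` varies, and for invariance under ties, where `old` and `small` vary.
    record Agree (E E′ : Word → A → Bool) (old old′ : Word → Bool) (small small′ : Symbol → Bool) : Set ℓ where
      field
        old-≗    : ∀ w → old w ≡ old′ w
        small-≗  : ∀ y → small y ≡ small′ y
        bits     : ∀ b → T (small (bit b))
        small-old : ∀ {w} → All (T ∘ small) w → T (old w)
        E-≗      : ∀ {w} → T (old w) → ∀ x → E w x ≡ E′ w x

    agree-sym : ∀ {E E′ old old′ small small′} → Agree E E′ old old′ small small′ → Agree E′ E old′ old small′ small
    agree-sym ag = record
      { old-≗ = λ w → sym (old-≗ w)
      ; small-≗ = λ y → sym (small-≗ y)
      ; bits = λ b → subst T (small-≗ _) (bits b)
      ; small-old = λ {w} ps → subst T (old-≗ w) (small-old (All.map (λ {y} → subst T (sym (small-≗ y))) ps))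
      ; E-≗ = λ {w} old′w x → sym (E-≗ (subst T (sym (old-≗ w)) old′w) x)
      }
      where open Agree ag

    module _ {E E′ old old′ small small′} (ag : Agree E E′ old old′ small small′) where
      open Agree ag

      private
        E-≗-small : ∀ {w} b → All (T ∘ small) w → ∀ x → E (bit b ∷ w) x ≡ E′ (bit b ∷ w) x
        E-≗-small b ps = E-≗ (small-old (bits b ∷ ps))

        listed-cong : ∀ {ws xs} → All (T ∘ old) ws → Pointwise (λ w x → T (E w x)) ws xs →
                      Pointwise (λ w x → T (E′ w x)) ws xs
        listed-cong [] [] = []
        listed-cong (o ∷ os) (p ∷ ps) = subst T (E-≗ o _) p ∷ listed-cong os ps

        pair-≗ : ∀ {w} → All (T ∘ small) w → ∀ x → pair E w x ≡ pair E′ w x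
        pair-≗ ps x = cong₂ _∨_ (E-≗-small false ps x) (E-≗-small true ps x)

      refuted-cong : ∀ {w} → Refuted E old small w → Refuted E′ old′ small′ w
      refuted-cong R = record
        { word-small = All.map (λ {y} → subst T (small-≗ y)) word-small
        ; ws-old     = All.map (λ {w} → subst T (old-≗ w)) ws-old
        ; coded      = trans (sym (code-cong small-≗ ws)) coded
        ; encoded    = encoded
        ; listed     = listed-cong ws-old listed
        ; value₀     = subst T (E-≗-small false word-small _) value₀
        ; value₁     = subst T (E-≗-small true word-small _) value₁
        ; separated  = separated
        }
        where open Refuted R

      glue-cong : ∀ {x y} → T (glue E old small x y) → T (glue E′ old′ small′ x y)
      glue-cong {x} {y} g with ∨⁻ (x == y) _ g
      ... | inj₁ x=y = ∨⁺ˡ (x == y) _ x=y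
      ... | inj₂ h = ∨⁺ʳ (x == y) _ (truth do
        w , R , px , py ← holds h
        let ≗ = pair-≗ (Refuted.word-small R)
        return (w , refuted-cong R , subst T (≗ x) px , subst T (≗ y) py))

      values-cong : ∀ {x} → T (values E old x) → T (values E′ old′ x)
      values-cong {x} v = truth do
        w , o , Ewx ← holds v
        return (w , subst T (old-≗ w) o , subst T (E-≗ o x) Ewx)

    diagonal-cong : ∀ {E E′ old old′ small small′} → Agree E E′ old old′ small small′ →
                    ∀ a → diagonal E old small a ≡ diagonal E′ old′ small′ a
    diagonal-cong ag a = T⇒≡ (go ag) (go (agree-sym ag))
      where
      go : ∀ {E E′ old old′ small small′} → Agree E E′ old old′ small small′ →
           T (diagonal E old small a) → T (diagonal E′ old′ small′ a)
      go ag d = truth do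
        xs , g , f ← holds d
        return (xs , G.respects (λ x y → T⇒≡ (glue-cong ag) (glue-cong (agree-sym ag))) g ,
                subst T (firstOutside-cong (λ x → T⇒≡ (values-cong ag) (values-cong (agree-sym ag))) xs a) f)

    -- One stage of the recursion: `old` holds of the words already treated, `small` of the symbols
    -- available for codes, and all other symbols of old words are tied with `m`.
    module Escape {E : Word → A → Bool} {old : Word → Bool} {small : Symbol → Bool} {m : Symbol}
             (E-respects : ∀ {w} → Respects (E w))
             (E-∼ : ∀ v w → v J.∼ w → ∀ {x} → T (E v x) → T (E w x))
             (isInjectiveOn : IsInjectiveOn wordOrder (T ∘ old) E)
             (bits : ∀ b → T (small (bit b)))
             (small-old : ∀ {w} → All (T ∘ small) w → T (old w))
             (old-symbols : ∀ {w} → T (old w) → All (λ y → ¬ T (small y) → y S.∼ m) w)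
             where
      private
        module E = IsInjectiveOn isInjectiveOn
        r₀ = glue E old small

        _∼ʷ_ : Word → Word → Set ℓ
        _∼ʷ_ = Pointwise S._∼_

        values-respects : Respects (values E old)
        values-respects x=y v = truth do
          w , o , Ewx ← holds v
          return (w , o , E-respects x=y Ewx)

        pair-respects : ∀ {w} → Respects (pair E w)
        pair-respects {w} {x} {y} x=y p with ∨⁻ (E (bit false ∷ w) x) _ p
        ... | inj₁ t = ∨⁺ˡ (E (bit false ∷ w) y) _ (E-respects x=y t)
        ... | inj₂ t = ∨⁺ʳ (E (bit false ∷ w) y) _ (E-respects x=y t)

        pair⁻ : ∀ {w x} → T (pair E w x) → ∃ λ b → T (E (bit b ∷ w) x)
        pair⁻ {w} {x} p with ∨⁻ (E (bit false ∷ w) x) _ p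
        ... | inj₁ t = false , t
        ... | inj₂ t = true , t

        pair⁺ : ∀ {w x} b → T (E (bit b ∷ w) x) → T (pair E w x)
        pair⁺ {w} {x} false = ∨⁺ˡ (E (bit false ∷ w) x) _
        pair⁺ {w} {x} true  = ∨⁺ʳ (E (bit false ∷ w) x) _

        bit-∼ : ∀ b b′ → bit b S.∼ bit b′ → b ≡ b′
        bit-∼ false false _ = refl
        bit-∼ true  true  _ = refl
        bit-∼ false true  p = contradiction p (proj₁ bits-differ)
        bit-∼ true  false p = contradiction p (proj₂ bits-differ)

        -- Injectivity on old words recovers the bit and, up to ties, the index of a pair from any
        -- of its elements.
        same-index : ∀ {v w x} b b′ → All (T ∘ small) v → All (T ∘ small) w →
                     T (E (bit b ∷ v) x) → T (E (bit b′ ∷ w) x) → b ≡ b′ × v ∼ʷ w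
        same-index {v} {w} b b′ sv sw t u
          with ∼⇒Pointwise-words {bit b ∷ v} {bit b′ ∷ w}
                 (E.injective (small-old (bits b ∷ sv)) (small-old (bits b′ ∷ sw)) t u)
        ... | p ∷ ps = bit-∼ b b′ p , ps

        shift : ∀ {v w x} b → v ∼ʷ w → T (E (bit b ∷ v) x) → T (E (bit b ∷ w) x)
        shift {v} {w} b ps = E-∼ (bit b ∷ v) (bit b ∷ w)
          (Pointwise⇒∼-words {bit b ∷ v} {bit b ∷ w} (S.∼-refl {bit b} ∷ ps))

        pair-shift : ∀ {v w x} → v ∼ʷ w → T (pair E v x) → T (pair E w x)
        pair-shift ps p with pair⁻ p
        ... | b , t = pair⁺ b (shift b ps t)

        same-pair : ∀ {v w x} → All (T ∘ small) v → All (T ∘ small) w → T (pair E v x) → T (pair E w x) → v ∼ʷ w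
        same-pair sv sw p q with pair⁻ p | pair⁻ q
        ... | b , t | b′ , u = proj₂ (same-index b b′ sv sw t u)

        glue⁺ : ∀ {x y w} → Refuted E old small w → T (pair E w x) → T (pair E w y) → T (r₀ x y)
        glue⁺ {x} {y} R p q = ∨⁺ʳ (x == y) _ (truth (return (_ , R , p , q)))

        glue⁻ : ∀ {x y} → T (r₀ x y) → ¬ ¬ (T (x == y) ⊎ ∃ λ w → Refuted E old small w × T (pair E w x) × T (pair E w y))
        glue⁻ {x} {y} g with ∨⁻ (x == y) _ g
        ... | inj₁ t = return (inj₁ t)
        ... | inj₂ h = holds h >>= λ q → return (inj₂ q)

        pair-finite : ∀ {w} → All (T ∘ small) w → ∃ᶜ λ L → ∀ y → T (pair E w y) → Any (λ z → T (y == z)) L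
        pair-finite {w} sw = do
          x₀ , t₀ ← E.total (small-old (bits false ∷ sw))
          x₁ , t₁ ← E.total (small-old (bits true ∷ sw))
          return (x₀ ∷ x₁ ∷ [] , λ y p → cover t₀ t₁ (pair⁻ p))
          where
          cover : ∀ {x₀ x₁ y} → T (E (bit false ∷ w) x₀) → T (E (bit true ∷ w) x₁) →
                  (∃ λ b → T (E (bit b ∷ w) y)) → Any (λ z → T (y == z)) (x₀ ∷ x₁ ∷ [])
          cover t₀ t₁ (false , t) = here (E.single (small-old (bits false ∷ sw)) t t₀)
          cover t₀ t₁ (true  , t) = there (here (E.single (small-old (bits true ∷ sw)) t t₁))

        isFinitary : IsFinitary r₀
        isFinitary = record
          { reflexive  = λ {x} {y} → ∨⁺ˡ (x == y) _
          ; symmetric  = λ g → T-stable (glue⁻ g >>= λ where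
              (inj₁ t) → return (∨⁺ˡ (_ == _) _ (==.sym t))
              (inj₂ (w , R , p , q)) → return (glue⁺ R q p))
          ; transitive = λ {x} {y} {z} g h → T-stable (glue⁻ g >>= λ g → glue⁻ h >>= λ h → return (tr g h))
          ; finite     = λ x → em (∃ λ w → Refuted E old small w × T (pair E w x)) >>= λ where
              (no none) → return (x ∷ [] , λ y g → here (T-stable (glue⁻ g >>= λ where
                (inj₁ t) → return (==.sym t)
                (inj₂ (w , R , p , _)) → contradiction (w , R , p) none)))
              (yes (w , R , p)) → do
                L , cov ← pair-finite (Refuted.word-small R)
                return (L , λ y g → cov y (T-stable (glue⁻ g >>= λ where
                  (inj₁ t) → return (pair-respects {w} t p)
                  (inj₂ (v , R′ , p′ , q′)) →
                    return (pair-shift (same-pair (Refuted.word-small R′) (Refuted.word-small R) p′ p) q′))))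
          }
          where
          tr : ∀ {x y z} →
               (T (x == y) ⊎ ∃ λ w → Refuted E old small w × T (pair E w x) × T (pair E w y)) →
               (T (y == z) ⊎ ∃ λ w → Refuted E old small w × T (pair E w y) × T (pair E w z)) → T (r₀ x z)
          tr (inj₁ t) (inj₁ u) = ∨⁺ˡ (_ == _) _ (==.trans t u)
          tr (inj₁ t) (inj₂ (w , R , p , q)) = glue⁺ R (pair-respects {w} (==.sym t) p) q
          tr (inj₂ (w , R , p , q)) (inj₁ t) = glue⁺ R p (pair-respects {w} t q)
          -- Two pairs that share `y` have tied indices and therefore coincide.
          tr (inj₂ (w , R , p , q)) (inj₂ (w′ , R′ , p′ , q′)) =
            glue⁺ R p (pair-shift (same-pair (Refuted.word-small R′) (Refuted.word-small R) p′ q) q′)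

        -- If all entries were old values, the words indexing them would have a code `v`. Whether or
        -- not `r₀` glues the pair indexed by `v`, a contradiction follows.
        escapes : ∀ {xs} → G r₀ xs → ¬ All (T ∘ values E old) xs
        escapes g all = All-choice (All.map holds all) λ (ws , ps) → unencodable g (proj₁ (split ps)) (proj₂ (split ps))
          where
          split : ∀ {xs ws} → Pointwise (λ x w → T (old w) × T (E w x)) xs ws →
                  All (T ∘ old) ws × Pointwise (λ w x → T (E w x)) ws xs
          split [] = [] , []
          split ((o , t) ∷ ps) with split ps
          ... | os , ts = o ∷ os , t ∷ ts
          same-values : ∀ {ws ws′ xs xs′} → Pointwise _∼ʷ_ ws ws′ → All (T ∘ old) ws′ →
                        Pointwise (λ w x → T (E w x)) ws xs → Pointwise (λ w x → T (E w x)) ws′ xs′ → xs ≋ xs′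
          same-values [] [] [] [] = []
          same-values (p ∷ ps) (o ∷ os) (t ∷ ts) (t′ ∷ ts′) =
            E.single o (E-∼ _ _ (Pointwise⇒∼-words p) t) t′ ∷ same-values ps os ts ts′
          unencodable : ∀ {xs ws} → G r₀ xs → All (T ∘ old) ws → Pointwise (λ w x → T (E w x)) ws xs → ⊥
          unencodable {xs} {ws} g os ts = E.total (small-old (bits false ∷ sv)) λ (x₀ , t₀) →
                                E.total (small-old (bits true ∷ sv)) λ (x₁ , t₁) → go x₀ x₁ t₀ t₁
            where
            v = code small ws
            sv : All (T ∘ small) v
            sv = code-small bits ws
            go : ∀ x₀ x₁ → T (E (bit false ∷ v) x₀) → T (E (bit true ∷ v) x₁) → ⊥
            go x₀ x₁ t₀ t₁ with T? (r₀ x₀ x₁)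
            -- Unglued, `v` enters the diagonal set with `r₀` as its own relation, and this glues
            -- its pair.
            ... | no  sep = sep (glue⁺ (record
              { word-small = sv
              ; ws-old     = os
              ; coded      = refl
              ; encoded    = g
              ; listed     = ts
              ; value₀     = t₀
              ; value₁     = t₁
              ; separated  = sep
              }) (pair⁺ false t₀) (pair⁺ true t₁))
            ... | yes glued = glue⁻ glued cases
              where
              refute : ∀ w → Refuted E old small w → w ∼ʷ v → ⊥
              -- Tied codes list the same values, so injectivity of `G` identifies the relation of
              -- `w` with `r₀`; but the former separates the pair which `r₀` glues.
              refute w R w∼v = separated (subst T (sym (G.injective xs≋ encoded g _ _)) glued′)
                where
                open Refuted R renaming (xs to xs′; ws to ws′; x₀ to y₀; x₁ to y₁)
                xs≋ : xs′ ≋ xs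
                xs≋ = same-values
                  (code-injective ws′ ws (All.map old-symbols ws-old) (All.map old-symbols os)
                    (subst (_∼ʷ v) (sym coded) w∼v))
                  os listed ts
                y₀=x₀ : T (y₀ == x₀)
                y₀=x₀ = E.single (small-old (bits false ∷ sv)) (shift false w∼v value₀) t₀
                y₁=x₁ : T (y₁ == x₁)
                y₁=x₁ = E.single (small-old (bits true ∷ sv)) (shift true w∼v value₁) t₁
                glued′ : T (r₀ y₀ y₁)
                glued′ = IsFinitary.transitive isFinitary (IsFinitary.reflexive isFinitary y₀=x₀)
                  (IsFinitary.transitive isFinitary glued (IsFinitary.reflexive isFinitary (==.sym y₁=x₁)))
              cases : ¬ (T (x₀ == x₁) ⊎ ∃ λ w → Refuted E old small w × T (pair E w x₀) × T (pair E w x₁))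
              cases (inj₁ x₀=x₁) = contradiction (proj₁ (same-index false true sv sv (E-respects x₀=x₁ t₀) t₁)) λ ()
              cases (inj₂ (w , R , p , q)) = refute w R (same-pair (Refuted.word-small R) sv p (pair⁺ false t₀))

      diagonal-exists : ∃ᶜ λ a → T (diagonal E old small a)
      diagonal-exists = do
        xs , g ← G.total isFinitary
        let a , f = firstOutside-exists xs (escapes g)
        return (a , truth (return (xs , g , f)))

      diagonal-unique : ∀ {a b} → T (diagonal E old small a) → T (diagonal E old small b) → T (a == b)
      diagonal-unique d d′ = T-stable do
        xs , g , f ← holds d
        ys , g′ , f′ ← holds d′
        return (firstOutside-unique values-respects (G.single g g′) f f′)

      diagonal-new : ∀ {w a} → T (old w) → T (E w a) → ¬ T (diagonal E old small a)
      diagonal-new o t d = holds d λ (xs , _ , f) →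
        firstOutside-outside values-respects xs f (truth (return (_ , o , t)))

    diagonal-respects : ∀ {E old small} → Respects (diagonal E old small)
    diagonal-respects x=y d = truth do
      xs , g , f ← holds d
      return (xs , g , firstOutside-respects xs x=y f)

-- The Hartogs number embeds in the set.

module Transfinite (lem : ClassicalLogic ℓ)
  (A : Set ℓ) (_==_ : A → A → Bool) (==-isEquivalence : IsEquivalence (λ x y → T (x == y)))
  {n} {G : (A → A → Bool) → List A → Set ℓ} (isEncoding : Sets.IsEncoding A _==_ ==-isEquivalence n G)
  (E₀ : ℕ → A → Bool) (E₀-total : ∀ i → ∃ᶜ λ a → T (E₀ i a))
  (E₀-single : ∀ {i a b} → T (E₀ i a) → T (E₀ i b) → T (a == b))
  (E₀-injective : ∀ {i j a} → T (E₀ i a) → T (E₀ j a) → i ≡ j)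
  (E₀-respects : ∀ i → Sets.Respects A _==_ ==-isEquivalence (E₀ i))
  where

  open Comprehension lem
  open Sets A _==_ ==-isEquivalence
  open Hartogs lem A
  open Words lem rankOrder
  open Diagonal lem rankOrder isEncoding

  private
    module S = WellOrder symbolOrder
    module J = WellOrder wordOrder

    -- Codes use both bits, so the diagonal can start only where some `ord x` occurs; words of bits
    -- take their values from the embedding of ω.
    V : Symbol → (Word → A → Bool) → Word → A → Bool
    V (bit _) E s = E₀ (number s)
    V (ord x) E s = diagonal E (λ t → t J.< s) (λ y → y S.< ord x)

    small-old : ∀ {s x} → maxSymbol s ≡ ord x → ∀ {w} → All (λ y → T (y S.< ord x)) w → T (w J.< s)
    small-old {s} eq ps = small-words {s} (subst (λ m → T (bit false S.< m)) (sym eq) _)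
      (subst (λ m → All (λ y → T (y S.< m)) _) (sym eq) ps)

    local : ∀ {E E′} s → (∀ t → T (t J.< s) → ∀ a → E t a ≡ E′ t a) →
            ∀ m → maxSymbol s ≡ m → ∀ a → V m E s a ≡ V m E′ s a
    local s agree (bit _) _  a = refl
    local s agree (ord x) eq = diagonal-cong (record
      { old-≗ = λ _ → refl ; small-≗ = λ _ → refl ; bits = λ _ → _
      ; small-old = small-old {s} eq ; E-≗ = λ {t} → agree t })

    open Recursion lem wordOrder (λ E s → V (maxSymbol s) E s) (λ s agree → local s agree (maxSymbol s) refl)
      renaming (fix to E; fix-unfold to E-unfold)

    unfold : ∀ {m} s → maxSymbol s ≡ m → ∀ a → E s a ≡ V m E s a
    unfold s refl = E-unfold s

    E-respects : ∀ {s} → Respects (E s)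
    E-respects {s} {x} {y} x=y e =
      subst T (sym (E-unfold s y)) (V-respects (maxSymbol s) (subst T (E-unfold s x) e))
      where
      V-respects : ∀ m → T (V m E s x) → T (V m E s y)
      V-respects (bit _) = E₀-respects (number s) x=y
      V-respects (ord z) = diagonal-respects x=y

    only-bit : ∀ {b} y → bit b S.≮ y → IsBit y
    only-bit (bit b) _ = is-bit b
    only-bit (ord x) p = contradiction _ p

    only-bits : ∀ {b w} → All (λ y → bit b S.≮ y) w → All IsBit w
    only-bits = All.map λ {y} → only-bit y

    bit-words-∼ : ∀ {v w} → All IsBit v → All IsBit w → Pointwise S._∼_ v w → v ≡ w
    bit-words-∼ [] [] [] = refl
    bit-words-∼ (is-bit false ∷ p) (is-bit false ∷ q) (_ ∷ r) = cong (_ ∷_) (bit-words-∼ p q r)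
    bit-words-∼ (is-bit true  ∷ p) (is-bit true  ∷ q) (_ ∷ r) = cong (_ ∷_) (bit-words-∼ p q r)
    bit-words-∼ (is-bit false ∷ p) (is-bit true  ∷ q) (r ∷ _) = contradiction r (proj₁ bits-differ)
    bit-words-∼ (is-bit true  ∷ p) (is-bit false ∷ q) (r ∷ _) = contradiction r (proj₂ bits-differ)

    bit-word : ∀ {s b} → maxSymbol s ≡ bit b → All IsBit s
    bit-word {s} eq = only-bits (subst (λ m → All (λ y → m S.≮ y) s) eq (maxSymbol-upper s))

    -- Tied words of bits are equal; for other words `old` and `small` depend on the word only up to
    -- ties.
    V-∼ : ∀ {s s′ m m′} → maxSymbol s ≡ m → maxSymbol s′ ≡ m′ → s J.∼ s′ → m S.∼ m′ → ∀ a → V m E s a ≡ V m′ E s′ a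
    V-∼ {s} {s′} {bit _} {bit _} eq eq′ s∼s′ _ a =
      cong (λ s → E₀ (number s) a) (bit-words-∼ (bit-word {s} eq) (bit-word {s′} eq′) (∼⇒Pointwise-words {s} {s′} s∼s′))
    V-∼ {m = bit _} {ord _} eq eq′ s∼s′ (p , _) a = contradiction _ p
    V-∼ {m = ord _} {bit _} eq eq′ s∼s′ (_ , p) a = contradiction _ p
    V-∼ {s} {s′} {ord x} {ord x′} eq eq′ (s≮s′ , s′≮s) (x≮x′ , x′≮x) = diagonal-cong (record
      { old-≗ = λ w → T⇒≡ (λ w<s → J.<-≮-trans {w} {s} w<s s′≮s) (λ w<s′ → J.<-≮-trans {w} {s′} w<s′ s≮s′)
      ; small-≗ = λ y → T⇒≡ (λ y<x → S.<-≮-trans {y} {ord x} y<x x′≮x) (λ y<x′ → S.<-≮-trans {y} {ord x′} y<x′ x≮x′)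
      ; bits = λ _ → _
      ; small-old = small-old {s} eq
      ; E-≗ = λ _ _ → refl
      })

    E-∼ : ∀ s s′ → s J.∼ s′ → ∀ {a} → T (E s a) → T (E s′ a)
    E-∼ s s′ s∼s′ {a} = subst T
      (trans (E-unfold s a) (trans (V-∼ {s} {s′} refl refl s∼s′ (∼⇒∼-max {s} {s′} s∼s′) a) (sym (E-unfold s′ a))))

    next : ∀ s → IsInjectiveOn wordOrder (λ t → T (t J.< s)) E → ∀ m → maxSymbol s ≡ m →
           (∃ᶜ λ a → T (V m E s a)) ×
           (∀ {a b} → T (V m E s a) → T (V m E s b) → T (a == b)) ×
           (∀ {t a} → T (t J.< s) → T (E t a) → ¬ T (V m E s a))
    next s inj (bit b) eq = E₀-total (number s) , E₀-single , λ {t} {a} t<s Eta e →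
        fresh {t} t<s (subst T (unfold t refl a) Eta) e (maxSymbol t) refl
      where
      fresh : ∀ {t a} → T (t J.< s) → T (V (maxSymbol t) E t a) → T (E₀ (number s) a) → ∀ m → maxSymbol t ≡ m → ⊥
      -- A predecessor of a word of bits is again a word of bits, so both values come from `E₀`, and
      -- `number` identifies the words.
      fresh {t} {a} t<s e e′ m eq′ = J.irrefl {s} (subst (λ t → T (t J.< s)) t≡s t<s)
        where
        t-bits : All IsBit t
        t-bits = only-bits (subst (λ m → All (λ y → m S.≮ y) t) eq (words-below {s} {t} t<s))
        max-bit : ∀ {w} → All IsBit w → ∃ λ b → maxSymbol w ≡ bit b
        max-bit [] = false , refl
        max-bit {x ∷ w} (is-bit b ∷ p) with maxSymbol w S.< x
        ... | true  = b , refl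
        ... | false = max-bit p
        t≡s : t ≡ s
        t≡s = number-injective t-bits (bit-word {s} eq)
          (E₀-injective (subst (λ m → T (V m E t a)) (proj₂ (max-bit t-bits)) e) e′)
    next s inj (ord x) eq = diagonal-exists , diagonal-unique , diagonal-new
      where
      old-symbols : ∀ {w} → T (w J.< s) → All (λ y → y S.≮ ord x → y S.∼ ord x) w
      old-symbols {w} w<s = All.map (λ x≮y y≮x → y≮x , x≮y)
        (subst (λ m → All (λ y → m S.≮ y) w) eq (words-below {s} {w} w<s))
      open Escape E-respects E-∼ inj (λ _ → _) (small-old {s} eq) old-symbols

    E-injective : IsInjectiveOn wordOrder (λ _ → ⊤) E
    E-injective = isInjective wordOrder lem E λ s inj →
      let ex , un , new = next s inj (maxSymbol s) refl in
      (do a , v ← ex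
          return (a , subst T (sym (E-unfold s a)) v)) ,
      (λ {a} {b} e e′ → un (subst T (E-unfold s a) e) (subst T (E-unfold s b) e′)) ,
      (λ {t} {a} t<s e e′ → new t<s e (subst T (E-unfold s a) e′))

  -- Restricted to the one-letter words `ord x ∷ []`, the embedding of the words maps the ranks
  -- injectively to `A`.
  impossible : ⊥
  impossible = no-injection (λ x → E (ord x ∷ [])) (λ x → E.total tt) λ {x} {y} Ex Ey x⊏y →
      proj₁ (Pw.head (∼⇒Pointwise-words {ord x ∷ []} {ord y ∷ []} (E.injective tt tt Ex Ey))) (truth (return x⊏y))
    where
    module E = IsInjectiveOn E-injective

-- Choice and counting for finite types.

Fin-choice : ∀ {k} {B : Set b} {R : Fin k → B → Set c} →
             (∀ i → ∃ᶜ λ y → R i y) → ∃ᶜ λ (f : Fin k → B) → ∀ i → R i (f i)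
Fin-choice {k = zero}  total = return ((λ ()) , λ ())
Fin-choice {k = suc k} total = do
  y , r ← total zero
  f , rs ← Fin-choice (total ∘ suc)
  return ((λ { zero → y ; (suc i) → f i }) , λ { zero → r ; (suc i) → rs i })

funToFin-cong : ∀ {m n} {f g : Fin m → Fin n} → f ≗ g → funToFin f ≡ funToFin g
funToFin-cong {zero}  f≗g = refl
funToFin-cong {suc m} f≗g = cong₂ combine (f≗g zero) (funToFin-cong (f≗g ∘ suc))

finToFun-injective : ∀ m n {i j : Fin (m ^ n)} → finToFun {m} {n} i ≗ finToFun {m} {n} j → i ≡ j
finToFun-injective m n {i} {j} eq = trans (sym (Fin.funToFin-finToFin {n} {m} i))
  (trans (funToFin-cong {f = finToFun i} {finToFun j} eq) (Fin.funToFin-finToFin {n} {m} j))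

funToFin-injective : ∀ {m n} (f g : Fin m → Fin n) → funToFin f ≡ funToFin g → f ≗ g
funToFin-injective f g eq i =
  trans (sym (Fin.finToFun-funToFin f i)) (trans (cong (λ k → finToFun k i) eq) (Fin.finToFun-funToFin g i))

-- From `3 + m ≤ (2 + m) ^ 2` the exponent `2 * n` already suffices for `≤`; one more factor makes
-- the inequality strict.
power-inequality : ∀ m n → (3 + m) ^ n ℕ.< (2 + m) ^ suc (2 * n)
power-inequality m n = begin-strict
  (3 + m) ^ n             ≤⟨ ℕ.^-monoˡ-≤ n square ⟩
  ((2 + m) ^ 2) ^ n       ≡⟨ ℕ.^-*-assoc (2 + m) 2 n ⟩
  (2 + m) ^ (2 * n)       <⟨ ℕ.^-monoʳ-< (2 + m) (s<s z<s) (ℕ.n<1+n (2 * n)) ⟩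
  (2 + m) ^ suc (2 * n)   ∎
  where
  open ℕ.≤-Reasoning
  square : 3 + m ≤ (2 + m) ^ 2
  square = begin
    3 + m               ≡⟨ ℕ.+-comm 1 (2 + m) ⟩
    (2 + m) + 1         ≤⟨ ℕ.+-monoʳ-≤ (2 + m) (s≤s z≤n) ⟩
    (2 + m) + (2 + m)   ≤⟨ ℕ.+-monoʳ-≤ (2 + m) (ℕ.m≤m+n (2 + m) (m * (2 + m))) ⟩
    (2 + m) * (2 + m)   ≡⟨ cong ((2 + m) *_) (ℕ.*-identityʳ (2 + m)) ⟨
    (2 + m) ^ 2         ∎

-- An embedding of ω, by counting.

natOrder : WellOrder (Lift ℓ ℕ)
natOrder = record
  { _<_       = λ m n → lower m <ᵇ lower n
  ; cotrans   = λ {m} {n} k m<n → cotrans (lower m) (lower k) (lower n) (ℕ.<ᵇ⇒< _ _ m<n)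
  ; asym      = λ {m} {n} m<n n<m → ℕ.<-asym (ℕ.<ᵇ⇒< (lower m) (lower n) m<n) (ℕ.<ᵇ⇒< _ _ n<m)
  ; induction = λ P prog (lift n) → <-rec (λ n → T (P (lift n)))
      (λ n ih → prog (lift n) λ (lift m) m<n → ih (ℕ.<ᵇ⇒< m n m<n)) n
  }
  where
  cotrans : ∀ m k n → m ℕ.< n → T (m <ᵇ k) ⊎ T (k <ᵇ n)
  cotrans m k n m<n with ℕ.<-≤-connex m k
  ... | inj₁ m<k = inj₁ (ℕ.<⇒<ᵇ m<k)
  ... | inj₂ k≤m = inj₂ (ℕ.<⇒<ᵇ (ℕ.≤-<-trans k≤m m<n))

lift-∼ : ∀ {i j} → WellOrder._∼_ (natOrder {ℓ}) (lift i) (lift j) → i ≡ j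
lift-∼ (i≮j , j≮i) = ℕ.≤-antisym (ℕ.≮⇒≥ (j≮i ∘ ℕ.<⇒<ᵇ)) (ℕ.≮⇒≥ (i≮j ∘ ℕ.<⇒<ᵇ))

module Omega (lem : ClassicalLogic ℓ)
  (A : Set ℓ) (_==_ : A → A → Bool) (==-isEquivalence : IsEquivalence (λ x y → T (x == y)))
  where

  open Sets A _==_ ==-isEquivalence

  private abstract
    member : ∀ {k} → (Fin k → A) → A → Bool
    member u x = isYes (Fin.any? λ i → T? (x == u i))

    member⁺ : ∀ {k} {u : Fin k → A} {x} i → T (x == u i) → T (member u x)
    member⁺ i p = fromWitness (i , p)

    member⁻ : ∀ {k} {u : Fin k → A} {x} → T (member u x) → ∃ λ i → T (x == u i)
    member⁻ = toWitness

    joined : ∀ {k} → (Fin k → List A) → List A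
    joined = concat ∘ tabulate

    joined-All : ∀ {p} {P : A → Set p} {k} {ys : Fin k → List A} → All P (joined ys) → ∀ i → All P (ys i)
    joined-All {ys = ys} ps = All.tabulate⁻ {f = ys} (All.concat⁻ {xss = tabulate ys} ps)

    joined-cong : ∀ {k} {ys zs : Fin k → List A} → (∀ i → ys i ≋ zs i) → joined ys ≋ joined zs
    joined-cong {ys = ys} {zs} eq = Pw.concat⁺ (Pw.tabulate⁺ {f = ys} {zs} eq)

  module Embedding
    {n} {G : (A → A → Bool) → List A → Set ℓ} (isEncoding : IsEncoding n G)
    (enc : List A → A → A → Bool)
    (enc-finitary  : ∀ xs → IsFinitary (enc xs))
    (enc-cong      : ∀ {xs ys} → xs ≋ ys → enc xs ≐ enc ys)
    (enc-injective : ∀ {xs ys} → length xs ≡ suc (2 * n) → length ys ≡ suc (2 * n) → enc xs ≐ enc ys → xs ≋ ys)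
    {u₀ u₁ : A} (u₀≠u₁ : ¬ T (u₀ == u₁))
    where

    open Comprehension lem
    private
      module G = IsEncoding isEncoding
      module ℕ< = WellOrder (natOrder {ℓ})

      N : ℕ
      N = suc (2 * n)

      tuple : ∀ {k} → (Fin k → A) → Fin (k ^ N) → List A
      tuple u b = tabulate (u ∘ finToFun {n = N} b)

      -- The elements at hand at stage `m`. The two starting elements make the counting work from
      -- stage 0 on.
      record Lists (E : Lift ℓ ℕ → A → Bool) (m : ℕ) (u : Fin (2 + m) → A) : Set where
        field
          first  : T (u₀ == u zero)
          second : T (u₁ == u (suc zero))
          others : ∀ i → T (E (lift (toℕ i)) (u (suc (suc i))))

      -- The sequences for all tuples are joined in the order of `Fin`, so the first new entry is
      -- canonical: by `value-unique` it depends on none of the witnesses stored here.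
      record Value (E : Lift ℓ ℕ → A → Bool) (m : ℕ) (a : A) : Set ℓ where
        field
          {u}     : Fin (2 + m) → A
          lists   : Lists E m u
          ys      : Fin ((2 + m) ^ N) → List A
          encoded : ∀ b → G (enc (tuple u b)) (ys b)
          isFirst : T (firstOutside (member u) (joined ys) a)

      V : (Lift ℓ ℕ → A → Bool) → Lift ℓ ℕ → A → Bool
      V E (lift m) a = ⟪ Value E m a ⟫

      V-local : ∀ {E E′} s → (∀ t → T (t ℕ<.< s) → ∀ a → E t a ≡ E′ t a) → ∀ a → V E s a ≡ V E′ s a
      V-local (lift m) agree a = T⇒≡ (go agree) (go (λ t t<s a → sym (agree t t<s a)))
        where
        transport : ∀ {E E′} → (∀ t → T (t ℕ<.< lift m) → ∀ a → E t a ≡ E′ t a) → Value E m a → Value E′ m a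
        transport agree v = record
          { lists   = record
            { first  = first
            ; second = second
            ; others = λ i → subst T (agree (lift (toℕ i)) (ℕ.<⇒<ᵇ (Fin.toℕ<n i)) _) (others i)
            }
          ; ys      = ys
          ; encoded = encoded
          ; isFirst = isFirst
          }
          where
          open Value v
          open Lists lists
        go : ∀ {E E′} → (∀ t → T (t ℕ<.< lift m) → ∀ a → E t a ≡ E′ t a) → T (V E (lift m) a) → T (V E′ (lift m) a)
        go agree v = truth (holds v >>= λ v → return (transport agree v))

      open Recursion lem natOrder V V-local renaming (fix to E; fix-unfold to E-unfold)

      unfold : ∀ {m a} → T (E (lift m) a) → ¬ ¬ Value E m a
      unfold e = holds (subst T (E-unfold _ _) e)

      fold : ∀ {m a} → ¬ ¬ Value E m a → T (E (lift m) a)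
      fold v = subst T (sym (E-unfold _ _)) (truth v)

      member-respects : ∀ {k} {u : Fin k → A} → Respects (member u)
      member-respects {u = u} x=y p with member⁻ {u = u} p
      ... | i , x=uᵢ = member⁺ {u = u} i (==.trans (==.sym x=y) x=uᵢ)

      value-outside : ∀ {E m a} → Value E m a → ¬ T (u₀ == a) × ¬ T (u₁ == a)
      value-outside {a = a} v = (outside zero ∘ λ u₀=a → ==.trans (==.sym u₀=a) first) ,
                        (outside (suc zero) ∘ λ u₁=a → ==.trans (==.sym u₁=a) second)
        where
        open Value v
        open Lists lists
        outside : ∀ i → ¬ T (a == u i)
        outside i p = firstOutside-outside (member-respects {u = u}) (joined ys) isFirst (member⁺ {u = u} i p)

      E-outside : ∀ {m a} → T (E (lift m) a) → ¬ T (u₀ == a) × ¬ T (u₁ == a)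
      E-outside e = (λ u₀=a → unfold e λ v → proj₁ (value-outside v) u₀=a) ,
                    (λ u₁=a → unfold e λ v → proj₂ (value-outside v) u₁=a)

      E-respects : ∀ s → Respects (E s)
      E-respects (lift m) {x} {y} x=y e = fold (unfold e >>= λ v → return (value-respects v))
        where
        value-respects : Value E m x → Value E m y
        value-respects v = record
          { lists   = lists
          ; ys      = ys
          ; encoded = encoded
          ; isFirst = firstOutside-respects (joined ys) x=y isFirst
          }
          where
          open Value v

      module Stage (m : ℕ) (below : IsInjectiveOn natOrder (λ t → T (t ℕ<.< lift m)) E) where
        module E = IsInjectiveOn below

        toℕ<m : ∀ (i : Fin m) → T (lift {ℓ = ℓ} (toℕ i) ℕ<.< lift m)
        toℕ<m i = ℕ.<⇒<ᵇ (Fin.toℕ<n i)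

        lists-exists : ∃ᶜ (Lists E m)
        lists-exists = do
          f , r ← Fin-choice (λ i → E.total (toℕ<m i))
          return ((λ { zero → u₀ ; (suc zero) → u₁ ; (suc (suc i)) → f i }) ,
            record { first = ==.refl ; second = ==.refl ; others = r })

        lists-unique : ∀ {u u′} → Lists E m u → Lists E m u′ → ∀ i → T (u i == u′ i)
        lists-unique l l′ zero = ==.trans (==.sym (Lists.first l)) (Lists.first l′)
        lists-unique l l′ (suc zero) = ==.trans (==.sym (Lists.second l)) (Lists.second l′)
        lists-unique l l′ (suc (suc i)) = E.single (toℕ<m i) (Lists.others l i) (Lists.others l′ i)

        E-index-unique : ∀ {a} i j → T (E (lift (toℕ i)) a) → T (E (lift (toℕ j)) a) → i ≡ j
        E-index-unique i j p q = Fin.toℕ-injective (lift-∼ {ℓ = ℓ} (E.injective (toℕ<m i) (toℕ<m j) p q))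

        module _ {u : Fin (2 + m) → A} (l : Lists E m u) where
          open Lists l

          first≠second : ¬ T (u zero == u (suc zero))
          first≠second p = u₀≠u₁ (==.trans first (==.trans p (==.sym second)))

          first≠others : ∀ i → ¬ T (u zero == u (suc (suc i)))
          first≠others i p = proj₁ (E-outside (others i)) (==.trans first p)

          second≠others : ∀ i → ¬ T (u (suc zero) == u (suc (suc i)))
          second≠others i p = proj₂ (E-outside (others i)) (==.trans second p)

          lists-injective : ∀ i j → T (u i == u j) → i ≡ j
          lists-injective zero          zero          _ = refl
          lists-injective zero          (suc zero)    p = contradiction p first≠second
          lists-injective zero          (suc (suc j)) p = contradiction p (first≠others j)
          lists-injective (suc zero)    zero          p = contradiction (==.sym p) first≠second
          lists-injective (suc zero)    (suc zero)    _ = refl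
          lists-injective (suc zero)    (suc (suc j)) p = contradiction p (second≠others j)
          lists-injective (suc (suc i)) zero          p = contradiction (==.sym p) (first≠others i)
          lists-injective (suc (suc i)) (suc zero)    p = contradiction (==.sym p) (second≠others i)
          lists-injective (suc (suc i)) (suc (suc j)) p =
            cong (λ k → suc (suc k)) (E-index-unique i j (E-respects (lift (toℕ i)) p (others i)) (others j))

        module _ {u : Fin (2 + m) → A} (l : Lists E m u) where

          -- The extra symbol `zero` stands for no entry, so that `k` symbols write every list of
          -- length at most `k`.
          cons : Fin (3 + m) → List A → List A
          cons zero    _  = []
          cons (suc i) xs = u i ∷ xs

          decode : ∀ {k} → (Fin k → Fin (3 + m)) → List A
          decode {zero}  f = []
          decode {suc k} f = cons (f zero) (decode (f ∘ suc))

          decode-cong : ∀ {k} {f g : Fin k → Fin (3 + m)} → f ≗ g → decode f ≡ decode g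
          decode-cong {zero}  f≗g = refl
          decode-cong {suc k} f≗g = cong₂ cons (f≗g zero) (decode-cong (f≗g ∘ suc))

          decode-surjective : ∀ {k} xs → length xs ≤ k → All (T ∘ member u) xs →
                              ∃ λ (f : Fin k → Fin (3 + m)) → xs ≋ decode f
          decode-surjective {zero}  [] _ _ = (λ ()) , []
          decode-surjective {suc k} [] _ _ = (λ _ → zero) , []
          decode-surjective {suc k} (x ∷ xs) (s≤s len) (p ∷ ps)
            with member⁻ {u = u} p | decode-surjective xs len ps
          ... | i , x=uᵢ | f , q = (λ { zero → suc i ; (suc j) → f j }) , x=uᵢ ∷ q

          -- Pigeonhole: `(2 + m) ^ N` tuples against `(3 + m) ^ n` ways to write a sequence in old
          -- elements. Two tuples would share a value, against injectivity of `G` and `enc`.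
          not-all-old : ∀ {ys} → (∀ b → G (enc (tuple u b)) (ys b)) → ¬ All (T ∘ member u) (joined ys)
          not-all-old {ys} encoded old = collide (Fin.pigeonhole (power-inequality m n) (λ b → funToFin (proj₁ (f b))))
            where
            f : ∀ b → ∃ λ (f : Fin n → Fin (3 + m)) → ys b ≋ decode f
            f b = decode-surjective (ys b) (G.bounded (encoded b)) (joined-All old b)
            collide : ¬ ∃₂ λ b b′ → toℕ b ℕ.< toℕ b′ × funToFin (proj₁ (f b)) ≡ funToFin (proj₁ (f b′))
            collide (b , b′ , b<b′ , eq) = ℕ.<⇒≢ b<b′ (cong toℕ (finToFun-injective (2 + m) N λ i →
                lists-injective l (finToFun b i) (finToFun b′ i)
                  (Pw.tabulate⁻ {f = u ∘ finToFun b} {u ∘ finToFun b′} tuple≋ i)))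
              where
              ys≋ : ys b ≋ ys b′
              ys≋ = Pw.transitive ==.trans (proj₂ (f b))
                (subst (_≋ ys b′) (sym (decode-cong (funToFin-injective (proj₁ (f b)) (proj₁ (f b′)) eq)))
                  (Pw.symmetric ==.sym (proj₂ (f b′))))
              same : enc (tuple u b) ≐ enc (tuple u b′)
              same = G.injective ys≋ (encoded b) (encoded b′)
              tuple≋ : tuple u b ≋ tuple u b′
              tuple≋ = enc-injective (length-tabulate (u ∘ finToFun {n = N} b))
                (length-tabulate (u ∘ finToFun {n = N} b′)) same

        value : ∀ {u} → Lists E m u → ∀ {ys} → (∀ b → G (enc (tuple u b)) (ys b)) → ∃ (Value E m)
        value l {ys} encoded =
          let a , f = firstOutside-exists (joined ys) (not-all-old l encoded)
          in a , record { lists = l ; ys = ys ; encoded = encoded ; isFirst = f }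

        value-exists : ∃ᶜ (Value E m)
        value-exists = do
          u , l ← lists-exists
          ys , encoded ← Fin-choice {R = λ b → G (enc (tuple u b))} (λ b → G.total (enc-finitary (tuple u b)))
          return (value l encoded)

        value-unique : ∀ {a b} → Value E m a → Value E m b → T (a == b)
        value-unique {a} {b} v v′ =
          firstOutside-unique (member-respects {u = v.u}) {joined v.ys} {joined v′.ys} ys≋ v.isFirst
            (subst T (firstOutside-cong {member v′.u} {member v.u} member-≗ (joined v′.ys) b) v′.isFirst)
          where
          module v = Value v
          module v′ = Value v′
          u= : ∀ i → T (v.u i == v′.u i)
          u= = lists-unique v.lists v′.lists
          member-≗ : ∀ x → member v′.u x ≡ member v.u x
          member-≗ x = T⇒≡
            (λ p → let i , q = member⁻ {u = v′.u} p in member⁺ {u = v.u} i (==.trans q (==.sym (u= i))))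
            (λ p → let i , q = member⁻ {u = v.u} p in member⁺ {u = v′.u} i (==.trans q (u= i)))
          ys≋ : joined v.ys ≋ joined v′.ys
          ys≋ = joined-cong (λ b → G.single
            (G.respects (enc-cong (Pw.tabulate⁺ λ i → u= (finToFun {n = N} b i))) (v.encoded b)) (v′.encoded b))

        value-new : ∀ {t a} → T (t ℕ<.< lift m) → T (E t a) → ¬ Value E m a
        value-new {lift t} {a} t<m e v = firstOutside-outside (member-respects {u = u}) (joined ys) isFirst
            (member⁺ (suc (suc i)) (E.single (toℕ<m i) e′ (Lists.others lists i)))
          where
          open Value v
          t<m′ = ℕ.<ᵇ⇒< t m t<m
          i = fromℕ< t<m′
          e′ : T (E (lift (toℕ i)) a)
          e′ = subst (λ t → T (E (lift t) a)) (sym (Fin.toℕ-fromℕ< t<m′)) e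

      E-injective : IsInjectiveOn natOrder (λ _ → ⊤) E
      E-injective = isInjective natOrder lem E next
        where
        next : ∀ s → IsInjectiveOn natOrder (λ t → T (t ℕ<.< s)) E →
               (∃ᶜ λ a → T (E s a)) ×
               (∀ {a b} → T (E s a) → T (E s b) → T (a == b)) ×
               (∀ {t a} → T (t ℕ<.< s) → T (E t a) → ¬ T (E s a))
        next (lift m) below =
          (Stage.value-exists m below >>= λ (a , v) → return (a , fold (return v))) ,
          (λ e e′ → T-stable (unfold e >>= λ v → unfold e′ >>= λ v′ → return (Stage.value-unique m below v v′))) ,
          (λ t<m e e′ → unfold e′ (Stage.value-new m below t<m e))

    omega : ℕ → A → Bool
    omega i = E (lift i)

    omega-total : ∀ i → ∃ᶜ λ a → T (omega i a)
    omega-total i = IsInjectiveOn.total E-injective {lift i} tt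

    omega-single : ∀ {i a b} → T (omega i a) → T (omega i b) → T (a == b)
    omega-single {i} = IsInjectiveOn.single E-injective {lift i} tt

    omega-injective : ∀ {i j a} → T (omega i a) → T (omega j a) → i ≡ j
    omega-injective {i} {j} p q =
      lift-∼ {ℓ = ℓ} (IsInjectiveOn.injective E-injective {lift i} {lift j} tt tt p q)

    omega-respects : ∀ i → Respects (omega i)
    omega-respects i = E-respects (lift i)

-- Writing sequences into finitary partitions.

-- A sequence is written on every group of N + 2 markers that it avoids: the
-- first two markers of the group are identified, and the others are identified
-- with the entries of the sequence, or with the first two beyond its end.
module Markers (A : Set ℓ) (_==_ : A → A → Bool) (==-isEquivalence : IsEquivalence (λ x y → T (x == y)))
  (N : ℕ) (marker : Fin (suc N) → Fin (2 + N) → A)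
  (marker-injective : ∀ {j i j′ i′} → T (marker j i == marker j′ i′) → j ≡ j′ × i ≡ i′)
  where

  open Sets A _==_ ==-isEquivalence

  private
    infix 4 _==ᵐ_
    _==ᵐ_ : Maybe A → Maybe A → Bool
    nothing ==ᵐ nothing = true
    just x  ==ᵐ just y  = x == y
    _       ==ᵐ _       = false

    ==ᵐ-sym : ∀ x y → T (x ==ᵐ y) → T (y ==ᵐ x)
    ==ᵐ-sym nothing  nothing  _ = _
    ==ᵐ-sym (just _) (just _) p = ==.sym p

    ==ᵐ-trans : ∀ x y z → T (x ==ᵐ y) → T (y ==ᵐ z) → T (x ==ᵐ z)
    ==ᵐ-trans nothing  nothing  nothing  _ _ = _
    ==ᵐ-trans (just _) (just _) (just _) p q = ==.trans p q

    Hits : A → Fin (suc N) → Set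
    Hits x j = ∃ λ i → T (x == marker j i)

    hits? : ∀ x j → Dec (Hits x j)
    hits? x j = Fin.any? λ i → T? (x == marker j i)

    Avoids : List A → Fin (suc N) → Set ℓ
    Avoids xs j = All (λ x → ¬ Hits x j) xs

    avoids? : ∀ xs j → Dec (Avoids xs j)
    avoids? xs j = All.all? (λ x → ¬? (hits? x j)) xs

    avoids-cong : ∀ {xs ys j} → xs ≋ ys → Avoids xs j → Avoids ys j
    avoids-cong [] [] = []
    avoids-cong (x=y ∷ ps) (¬h ∷ av) = (λ (i , q) → ¬h (i , ==.trans x=y q)) ∷ avoids-cong ps av

    -- Distinct markers let an entry hit at most one group, and `N` entries cannot hit `N + 1`
    -- groups.
    some-avoided : ∀ xs → length xs ≤ N → ∃ (Avoids xs)
    some-avoided xs len with Fin.any? (avoids? xs)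
    ... | yes p = p
    ... | no ¬p = contradiction (Fin.pigeonhole (s≤s len) (λ j → Any.index (hit j))) no-collision
      where
      hit : ∀ j → Any (λ x → ¬ ¬ Hits x j) xs
      hit j = All.¬All⇒Any¬ (λ x → ¬? (hits? x j)) xs λ av → ¬p (j , av)
      no-collision : ¬ ∃₂ λ j j′ → toℕ j ℕ.< toℕ j′ × Any.index (hit j) ≡ Any.index (hit j′)
      no-collision (j , j′ , j<j′ , eq) =
        Any.lookup-index (hit j) λ (i , p) →
        subst (λ k → ¬ ¬ Hits (lookup xs k) j′) (sym eq) (Any.lookup-index (hit j′)) λ (i′ , p′) →
        ℕ.<⇒≢ j<j′ (cong toℕ (proj₁ (marker-injective (==.trans (==.sym p) p′))))

    nth : List A → ℕ → Maybe A
    nth []       _       = nothing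
    nth (x ∷ _)  zero    = just x
    nth (_ ∷ xs) (suc k) = nth xs k

    nth-cong : ∀ {xs ys} → xs ≋ ys → ∀ k → T (nth xs k ==ᵐ nth ys k)
    nth-cong []        k       = _
    nth-cong (p ∷ ps) zero    = p
    nth-cong (p ∷ ps) (suc k) = nth-cong ps k

    nth-injective : ∀ {M} xs ys → length xs ≤ M → length ys ≤ M →
                    (∀ (k : Fin M) → T (nth xs (toℕ k) ==ᵐ nth ys (toℕ k))) → xs ≋ ys
    nth-injective []       []       _ _ _ = []
    nth-injective []       (_ ∷ _) _ (s≤s _) eq = ⊥-elim (eq zero)
    nth-injective (_ ∷ _)  []       (s≤s _) _ eq = ⊥-elim (eq zero)
    nth-injective (x ∷ xs) (y ∷ ys) (s≤s l) (s≤s l′) eq = eq zero ∷ nth-injective xs ys l l′ (eq ∘ suc)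

    nth-∈ : ∀ {p} {P : A → Set p} xs k {x} → nth xs k ≡ just x → All P xs → P x
    nth-∈ (x ∷ xs) zero    refl (p ∷ _)  = p
    nth-∈ (x ∷ xs) (suc k) eq   (_ ∷ ps) = nth-∈ xs k eq ps

    slot : List A → Fin (2 + N) → Maybe A
    slot xs zero          = nothing
    slot xs (suc zero)    = nothing
    slot xs (suc (suc k)) = nth xs (toℕ k)

    slot-cong : ∀ {xs ys} → xs ≋ ys → ∀ i → T (slot xs i ==ᵐ slot ys i)
    slot-cong ps zero          = _
    slot-cong ps (suc zero)    = _
    slot-cong ps (suc (suc k)) = nth-cong ps (toℕ k)

    Written : List A → A → Set ℓ
    Written xs x = ∃₂ λ j i → T (x == marker j i) × Avoids xs j

    written? : ∀ xs x → Dec (Written xs x)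
    written? xs x with Fin.any? (hits? x)
    ... | no ¬p = no λ (j , i , p , _) → ¬p (j , i , p)
    ... | yes (j , i , p) with avoids? xs j
    ...   | yes av = yes (j , i , p , av)
    ...   | no ¬av = no λ (j′ , i′ , p′ , av) →
              ¬av (subst (Avoids xs) (proj₁ (marker-injective (==.trans (==.sym p′) p))) av)

    label : List A → A → Maybe A
    label xs x with written? xs x
    ... | yes (_ , i , _) = slot xs i
    ... | no _            = just x

    label-written : ∀ {xs x j i} → T (x == marker j i) → Avoids xs j → label xs x ≡ slot xs i
    label-written {xs} {x} {j} {i} p av with written? xs x
    ... | yes (_ , _ , p′ , _) = cong (slot xs) (proj₂ (marker-injective (==.trans (==.sym p′) p)))
    ... | no ¬w = contradiction (j , i , p , av) ¬w

    label-unwritten : ∀ {xs x} → ¬ Written xs x → label xs x ≡ just x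
    label-unwritten {xs} {x} ¬w with written? xs x
    ... | yes w = contradiction w ¬w
    ... | no _  = refl

    written-cong : ∀ {xs ys x y} → xs ≋ ys → T (x == y) → Written xs x → Written ys y
    written-cong ps x=y (j , i , p , av) = j , i , ==.trans (==.sym x=y) p , avoids-cong ps av

    ≋-refl : ∀ {xs} → xs ≋ xs
    ≋-refl = Pw.refl ==.refl

    ≋-sym : ∀ {xs ys} → xs ≋ ys → ys ≋ xs
    ≋-sym = Pw.symmetric ==.sym

    label-cong : ∀ {xs ys x y} → xs ≋ ys → T (x == y) → T (label xs x ==ᵐ label ys y)
    label-cong {xs} {ys} {x} {y} ps x=y with written? xs x | written? ys y
    ... | yes (_ , i , p , _) | yes (_ , _ , p′ , _) =
      subst (λ i′ → T (slot xs i ==ᵐ slot ys i′))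
        (proj₂ (marker-injective (==.trans (==.sym p) (==.trans x=y p′)))) (slot-cong ps i)
    ... | yes w | no ¬w = contradiction (written-cong ps x=y w) ¬w
    ... | no ¬w | yes w = contradiction (written-cong (≋-sym ps) (==.sym x=y) w) ¬w
    ... | no _  | no _  = x=y

  enc : List A → A → A → Bool
  enc xs x y = label xs x ==ᵐ label xs y

  enc-cong : ∀ {xs ys} → xs ≋ ys → enc xs ≐ enc ys
  enc-cong {xs} {ys} ps x y = T⇒≡ (go ps) (go (≋-sym ps))
    where
    go : ∀ {xs ys} → xs ≋ ys → T (enc xs x y) → T (enc ys x y)
    go {xs} {ys} ps e = ==ᵐ-trans (label ys x) (label xs x) _ (label-cong (≋-sym ps) ==.refl)
      (==ᵐ-trans (label xs x) (label xs y) _ e (label-cong ps ==.refl))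

  enc-finitary : ∀ xs → IsFinitary (enc xs)
  enc-finitary xs = record
    { reflexive  = label-cong ≋-refl
    ; symmetric  = λ {x} {y} → ==ᵐ-sym (label xs x) (label xs y)
    ; transitive = λ {x} {y} {z} → ==ᵐ-trans (label xs x) (label xs y) (label xs z)
    -- Besides markers, a block contains at most the element named by its label.
    ; finite     = λ x → return (markers ++ fromMaybe (label xs x) , cover x)
    }
    where
    markers : List A
    markers = concat (tabulate λ j → tabulate (marker j))
    cover : ∀ x y → T (enc xs x y) → Any (λ z → T (y == z)) (markers ++ fromMaybe (label xs x))
    cover x y e with label xs x | written? xs y
    ... | _ | yes (j , i , p , _) =
      Any.++⁺ˡ (Any.concat⁺ (Any.tabulate⁺ {f = λ j → tabulate (marker j)} j (Any.tabulate⁺ {f = marker j} i p)))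
    ... | just z  | no ¬w = Any.++⁺ʳ markers (here (==.sym e))

  -- A group avoided by `xs` is avoided by `ys` too. In it, the block of the marker of position `k`
  -- reveals the entry: it contains either the first marker, past the end, or the entry itself.
  enc-injective : ∀ {xs ys} → length xs ≤ N → length ys ≤ N → enc xs ≐ enc ys → xs ≋ ys
  enc-injective {xs} {ys} lx ly same = nth-injective xs ys lx ly entry
    where
    -- The first two markers of a group are identified exactly if the group is
    -- avoided.
    signature : ∀ {xs ys j} → enc xs ≐ enc ys → Avoids xs j → Avoids ys j
    signature {xs} {ys} {j} same av with avoids? ys j
    ... | yes av′ = av′
    ... | no ¬av′ = contradiction (marker-injective (equal (subst T (same q₀ q₁) identified))) λ ()
      where
      q₀ = marker j zero
      q₁ = marker j (suc zero)
      identified : T (enc xs q₀ q₁)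
      identified rewrite label-written {xs} {q₀} {j} {zero} ==.refl av
                       | label-written {xs} {q₁} {j} {suc zero} ==.refl av = _
      unwritten : ∀ i → ¬ Written ys (marker j i)
      unwritten i (j′ , i′ , p , av′) = ¬av′ (subst (Avoids ys) (sym (proj₁ (marker-injective p))) av′)
      equal : T (enc ys q₀ q₁) → T (q₀ == q₁)
      equal e rewrite label-unwritten {ys} (unwritten zero)
                    | label-unwritten {ys} (unwritten (suc zero)) = e
    same′ : enc ys ≐ enc xs
    same′ x y = sym (same x y)
    j = proj₁ (some-avoided xs lx)
    av : Avoids xs j
    av = proj₂ (some-avoided xs lx)
    entry : ∀ k → T (nth xs (toℕ k) ==ᵐ nth ys (toℕ k))
    entry k with nth xs (toℕ k) in eq
    ... | nothing = subst T (trans (same q p)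
                      (cong₂ _==ᵐ_ (label-written ==.refl (signature same av))
                                   (label-written ==.refl (signature same av)))) at-xs
      where
      p = marker j (suc (suc k))
      q = marker j zero
      at-xs : T (enc xs q p)
      at-xs = subst T (sym (cong₂ _==ᵐ_ (label-written ==.refl av) (trans (label-written ==.refl av) eq))) _
    ... | just a = subst T (trans (same a p)
                      (cong₂ _==ᵐ_ (label-unwritten a-unwritten′) (label-written ==.refl (signature same av)))) at-xs
      where
      p = marker j (suc (suc k))
      a-avoids : ∀ {j} → Avoids xs j → ¬ Hits a j
      a-avoids = nth-∈ xs (toℕ k) eq
      a-unwritten : ¬ Written xs a
      a-unwritten (_ , i , p , av) = a-avoids av (i , p)
      a-unwritten′ : ¬ Written ys a
      -- Read backwards, `signature` turns a group avoided by `ys` into one avoided by `xs`, which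
      -- the entry `a` of `xs` cannot hit.
      a-unwritten′ (_ , i , p , av) = a-avoids (signature same′ av) (i , p)
      at-xs : T (enc xs a p)
      at-xs = subst T (sym (cong₂ _==ᵐ_ (label-unwritten a-unwritten) (trans (label-written ==.refl av) eq))) ==.refl

-- Excluded middle at lower levels; finite and infinite setoids.

lower-lem : ∀ a b → ClassicalLogic (a ⊔ b) → ClassicalLogic a
lower-lem a b lem {P} stable = map′ lower lift (lem {Lift b P} λ ¬¬p → lift (stable λ ¬p → ¬¬p (¬p ∘ lower)))

module Covering (S : Setoid s t) where
  open Setoid S renaming (refl to ≈-refl; sym to ≈-sym; trans to ≈-trans)

  Distinct : ∀ {k} → (Fin k → Carrier S) → Set t
  Distinct f = ∀ i j → f i ≈ f j → i ≡ j

  extend : ∀ {k} → Carrier S → (Fin k → Carrier S) → Fin (suc k) → Carrier S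
  extend x f zero    = x
  extend x f (suc i) = f i

  extend-distinct : ∀ {k x} {f : Fin k → Carrier S} → ¬ (∃ λ i → x ≈ f i) → Distinct f → Distinct (extend x f)
  extend-distinct x∉f d zero    zero     _ = refl
  extend-distinct x∉f d zero    (suc j) p = contradiction (j , p) x∉f
  extend-distinct x∉f d (suc i) zero    p = contradiction (i , ≈-sym p) x∉f
  extend-distinct x∉f d (suc i) (suc j) p = cong suc (d i j p)

  -- Repetitions are dropped one by one, each test taking place under the double negation.
  enumerate : ∀ L → ∃ᶜ λ k → ∃ λ (f : Fin k → Carrier S) → Distinct f × (∀ x → Any (x ≈_) L → ∃ λ i → x ≈ f i)
  enumerate [] = return (0 , (λ ()) , (λ ()) , λ _ ())
  enumerate (x ∷ L) = enumerate L >>= λ (k , f , d , cover) → em (∃ λ i → x ≈ f i) >>= λ where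
    (yes (i , x≈fi)) → return (k , f , d , λ { _ (here y≈x) → i , ≈-trans y≈x x≈fi ; y (there p) → cover y p })
    (no  x∉f)        → return (suc k , extend x f , extend-distinct x∉f d , λ where
      _ (here y≈x) → zero , y≈x
      y (there p)  → let i , y≈fi = cover y p in suc i , y≈fi)

  module _ (lem : ClassicalLogic t) where
    open Comprehension lem

    finite : ∀ L → (∀ x → ¬ ¬ Any (x ≈_) L) → Finite S
    finite L covered = do
      k , f , d , cover ← enumerate L
      let
        F : Relation S (≡.setoid (Fin k))
        F = record
          { to   = λ (x , i) → ⟪ x ≈ f i ⟫
          ; cong = λ { (x≈y , refl) → T⇒≡ (λ p → truth (holds p >>= λ q → return (≈-trans (≈-sym x≈y) q)))
                                           (λ p → truth (holds p >>= λ q → return (≈-trans x≈y q))) }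
          }
      return (k , return (F , record
        { isInjection = record
          { isFunction = record
            { total        = λ x → covered x >>= λ p → let i , q = cover x p in return (i , truth (return q))
            ; singleValued = λ p q → holds p >>= λ p → holds q >>= λ q → return (d _ _ (≈-trans (≈-sym p) q))
            }
          ; injective = λ p q → holds p >>= λ p → holds q >>= λ q → return (≈-trans p (≈-sym q))
          }
        ; surjective = λ i → return (f i , truth (return ≈-refl))
        }))

    module _ (infinite : Infinite S) where

      -- A family with nothing outside it would cover `S` and make it finite. Each `k` is treated
      -- separately, so no sequence of elements is chosen.
      distinct : ∀ k → ∃ᶜ λ (f : Fin k → Carrier S) → Distinct f
      distinct zero    = return ((λ ()) , λ ())
      distinct (suc k) = do
        f , d ← distinct k
        x , x∉f ← λ none → infinite (finite (tabulate f) λ x x∉f → none (x , λ (i , p) → x∉f (Any.tabulate⁺ i p)))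
        return (extend x f , extend-distinct x∉f d)

-- Partitions as Boolean equivalence relations; the injection and the absence of a bijection.

module Bridge (lem : ClassicalLogic (c ⊔ e)) (A : Setoid c e) where
  private
    module A = Setoid A
    lemᶜ = lower-lem c e lem
    lemᵉ = lower-lem e c lem
    module Cᵉ = Comprehension lemᵉ
    module Cᶜ = Comprehension lemᶜ

  _==_ : A.Carrier → A.Carrier → Bool
  x == y = Cᵉ.⟪ x A.≈ y ⟫

  ==⁺ : ∀ {x y} → ¬ ¬ x A.≈ y → T (x == y)
  ==⁺ = Cᵉ.truth

  ==⁻ : ∀ {x y} → T (x == y) → ¬ ¬ x A.≈ y
  ==⁻ = Cᵉ.holds

  ==-isEquivalence : IsEquivalence (λ x y → T (x == y))
  ==-isEquivalence = record
    { refl  = ==⁺ (return A.refl)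
    ; sym   = λ p → ==⁺ (==⁻ p >>= λ q → return (A.sym q))
    ; trans = λ p q → ==⁺ (==⁻ p >>= λ p → ==⁻ q >>= λ q → return (A.trans p q))
    }

  open Sets A.Carrier _==_ ==-isEquivalence

  ≋⁺ : ∀ {xs ys} → ¬ ¬ Pointwise A._≈_ xs ys → xs ≋ ys
  ≋⁺ p = ≋-stable (p >>= λ ps → return (Pw.map (λ q → ==⁺ (return q)) ps))

  ≋⁻ : ∀ {xs ys} → xs ≋ ys → ¬ ¬ Pointwise A._≈_ xs ys
  ≋⁻ []       = return []
  ≋⁻ (p ∷ ps) = ==⁻ p >>= λ q → ≋⁻ ps >>= λ qs → return (q ∷ qs)

  module _ {r : A.Carrier → A.Carrier → Bool} (r-finitary : IsFinitary r) where
    private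
      module r = IsFinitary r-finitary

      r-refl : ∀ {x} → T (r x x)
      r-refl = r.reflexive ==.refl

      IsClass : Carrier (𝒫 A) → A.Carrier → Set c
      IsClass P x = ∀ y → P ⟨$⟩ y ≡ r x y

    class : A.Carrier → Carrier (𝒫 A)
    class x = record
      { to   = r x
      ; cong = λ y≈z → T⇒≡ (λ p → r.transitive p (r.reflexive (==⁺ (return y≈z))))
                            (λ p → r.transitive p (r.reflexive (==⁺ (return (A.sym y≈z)))))
      }

    -- A block is any subset with the elements of some class, which makes the predicate extensional.
    classes : Carrier (𝒫 (𝒫 A))
    classes = record
      { to   = λ P → Cᶜ.⟪ ∃ (IsClass P) ⟫
      ; cong = λ {P} {Q} P≈Q → T⇒≡
          (λ p → Cᶜ.truth (Cᶜ.holds p >>= λ (x , f) → return (x , λ y → trans (sym (P≈Q y)) (f y))))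
          (λ p → Cᶜ.truth (Cᶜ.holds p >>= λ (x , f) → return (x , λ y → trans (P≈Q y) (f y))))
      }

    class-∈ : ∀ x → T (classes ⟨$⟩ class x)
    class-∈ x = Cᶜ.truth (return (x , λ _ → refl))

    private
      same-class : ∀ {x x′ z} → T (r x z) → T (r x′ z) → ∀ y → r x y ≡ r x′ y
      same-class p q y = T⇒≡ (λ t → r.transitive q (r.transitive (r.symmetric p) t))
                             (λ t → r.transitive p (r.transitive (r.symmetric q) t))

      members : (P : Carrier (𝒫 A)) → List A.Carrier → List (Carrier (Elements A P))
      members P []      = []
      members P (x ∷ L) with T? (P ⟨$⟩ x)
      ... | yes x∈P = (x , x∈P) ∷ members P L
      ... | no  _   = members P L

      members-cover : ∀ P L {x} (x∈P : T (P ⟨$⟩ x)) → Any (λ z → T (x == z)) L →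
                      ¬ ¬ Any (λ (z , _) → x A.≈ z) (members P L)
      members-cover P (z ∷ L) {x} x∈P p with T? (P ⟨$⟩ z) | p
      ... | yes _   | here x=z = ==⁻ x=z >>= λ x≈z → return (here x≈z)
      ... | no  z∉P | here x=z = ==⁻ x=z >>= λ x≈z → contradiction (subst T (Func.cong P x≈z) x∈P) z∉P
      ... | yes _   | there q  = members-cover P L x∈P q >>= λ q → return (there q)
      ... | no  _   | there q  = members-cover P L x∈P q

    classes-isFinitary : IsFinitaryPartition A classes
    classes-isFinitary = record
      { isPartition = record
        { nonempty = λ P∈ → Cᶜ.holds P∈ >>= λ (x , f) → return (x , subst T (sym (f x)) r-refl)
        ; disjoint = λ {P} {Q} {z} P∈ Q∈ z∈P z∈Q y → ≡-stable (
            Cᶜ.holds P∈ >>= λ (x , f) → Cᶜ.holds Q∈ >>= λ (x′ , g) →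
            return (trans (f y) (trans (same-class (subst T (f z) z∈P) (subst T (g z) z∈Q) y) (sym (g y)))))
        ; covering = λ x → return (class x , class-∈ x , r-refl)
        }
      ; finiteBlocks = λ {P} P∈ → Cᶜ.holds P∈ >>= λ (x , f) → r.finite x >>= λ (L , cover) →
          Covering.finite (Elements A P) lemᵉ (members P L) λ (y , y∈P) →
            members-cover P L y∈P (cover y (subst T (f y) y∈P))
      }

    toPartition : Carrier (Part-fin A)
    toPartition = classes , classes-isFinitary

  open Setoid (Part-fin A) using () renaming (_≈_ to _≈ₚ_)

  module _ {r r′ : A.Carrier → A.Carrier → Bool} (p : IsFinitary r) (p′ : IsFinitary r′) where

    toPartition-cong : r ≐ r′ → toPartition p ≈ₚ toPartition p′
    toPartition-cong r≐r′ P = T⇒≡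
      (λ t → Cᶜ.truth (Cᶜ.holds t >>= λ (x , f) → return (x , λ y → trans (f y) (r≐r′ x y))))
      (λ t → Cᶜ.truth (Cᶜ.holds t >>= λ (x , f) → return (x , λ y → trans (f y) (sym (r≐r′ x y)))))

    -- The `r`-class of `x` is a block of the other partition, hence an `r′`-class, and it contains
    -- both `x` and `y`.
    toPartition-⊆ : toPartition p ≈ₚ toPartition p′ → ∀ x y → T (r x y) → T (r′ x y)
    toPartition-⊆ eq x y rxy = T-stable do
      x′ , f ← Cᶜ.holds (subst T (eq (class p x)) (class-∈ p x))
      return (IsFinitary.transitive p′
        (IsFinitary.symmetric p′ (subst T (f x) (IsFinitary.reflexive p ==.refl)))
        (subst T (f y) rxy))

  toPartition-injective : ∀ {r r′} (p : IsFinitary r) (p′ : IsFinitary r′) → toPartition p ≈ₚ toPartition p′ → r ≐ r′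
  toPartition-injective p p′ eq x y = T⇒≡ (toPartition-⊆ p p′ eq x y) (toPartition-⊆ p′ p (λ P → sym (eq P)) x y)

  isFinitary-respects : ∀ {r r′} → r ≐ r′ → IsFinitary r → IsFinitary r′
  isFinitary-respects {r} {r′} eq p = record
    { reflexive  = λ x=y → to (reflexive x=y)
    ; symmetric  = λ rxy → to (symmetric (from rxy))
    ; transitive = λ rxy ryz → to (transitive (from rxy) (from ryz))
    ; finite     = λ x → finite x >>= λ (L , cover) → return (L , λ y rxy → cover y (from rxy))
    }
    where
    open IsFinitary p
    to : ∀ {x y} → T (r x y) → T (r′ x y)
    to = subst T (eq _ _)
    from : ∀ {x y} → T (r′ x y) → T (r x y)
    from = subst T (sym (eq _ _))

  module _ (infinite : Infinite A) where

    module WithMarkers (N : ℕ) (f : Fin (suc N * (2 + N)) → A.Carrier) (f-distinct : Covering.Distinct A f) where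

      -- `combine` cuts the family of distinct elements into `N + 1` groups of `N + 2`.
      marker : Fin (suc N) → Fin (2 + N) → A.Carrier
      marker j i = f (combine j i)

      marker-injective : ∀ {j i j′ i′} → T (marker j i == marker j′ i′) → j ≡ j′ × i ≡ i′
      marker-injective {j} {i} {j′} {i′} p = Fin.combine-injective j i j′ i′
        (decidable-stable (combine j i Fin.≟ combine j′ i′) (==⁻ p >>= λ q → return (f-distinct _ _ q)))

      open Markers A.Carrier _==_ ==-isEquivalence N marker marker-injective public

    injection : ∀ n → ∣ seq≤ n A ∣≤∣ Part-fin A ∣
    injection n = Covering.distinct A lemᵉ infinite (suc n * (2 + n)) >>= λ (f , f-distinct) →
        return (write f f-distinct)
      where
      open Comprehension lem
      module P = Setoid (Part-fin A)
      write : (f : Fin (suc n * (2 + n)) → A.Carrier) → Covering.Distinct A f → ∃ (IsInjection (seq≤ n A) (Part-fin A))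
      write f f-distinct = F , record
        { isFunction = record
          { total        = λ (xs , _) → return (part xs , truth (return (P.refl {part xs})))
          ; singleValued = λ {(xs , _)} {Π} {Π′} p q → holds p >>= λ p → holds q >>= λ q →
              return (P.trans {Π} {part xs} {Π′} p (P.sym {Π′} {part xs} q))
          }
        ; injective = λ {(xs , lx)} {(ys , ly)} {Π} p q → holds p >>= λ p → holds q >>= λ q →
            ≋⁻ (enc-injective lx ly (toPartition-injective (enc-finitary xs) (enc-finitary ys)
              (P.trans {part xs} {Π} {part ys} (P.sym {Π} {part xs} p) q)))
        }
        where
        open WithMarkers n f f-distinct
        part : List A.Carrier → P.Carrier
        part xs = toPartition (enc-finitary xs)
        part-cong : ∀ {xs ys} → Pointwise A._≈_ xs ys → part xs P.≈ part ys
        part-cong {xs} {ys} ps =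
          toPartition-cong (enc-finitary xs) (enc-finitary ys) (enc-cong (≋⁺ (return ps)))
        move : ∀ {xs ys Π Π′} → Pointwise A._≈_ xs ys → Π P.≈ Π′ → T ⟪ Π P.≈ part xs ⟫ → T ⟪ Π′ P.≈ part ys ⟫
        move {xs} {ys} {Π} {Π′} ps Π≈Π′ p = truth (holds p >>= λ q →
          return (P.trans {Π′} {Π} {part ys} (P.sym {Π} {Π′} Π≈Π′) (P.trans {Π} {part xs} {part ys} q (part-cong ps))))
        F : Relation (seq≤ n A) (Part-fin A)
        F = record
          { to   = λ ((xs , _) , Π) → ⟪ Π P.≈ part xs ⟫
          ; cong = λ { {_ , Π} {_ , Π′} (ps , Π≈Π′) → T⇒≡
              (move {Π = Π} {Π′} ps Π≈Π′)
              (move {Π = Π′} {Π} (Pw.symmetric A.sym ps) (P.sym {Π} {Π′} Π≈Π′)) }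
          }

    module _ {n : ℕ} (F : Relation (seq≤ n A) (Part-fin A)) (F-bijection : IsBijection (seq≤ n A) (Part-fin A) F) where
      open IsBijection F-bijection
      open IsInjection isInjection
      open IsFunction isFunction

      -- The converse of `F`, read on equivalence relations; the choice of `p` does not matter, by
      -- `toPartition-cong`.
      G : (A.Carrier → A.Carrier → Bool) → List A.Carrier → Set c
      G r xs = ∃ᶜ λ (p : IsFinitary r) → ∃ λ (len : length xs ≤ n) → T (F ⟨$⟩ ((xs , len) , toPartition p))

      -- Passing to the converse exchanges the properties: surjectivity of `F` gives totality,
      -- injectivity gives uniqueness, and single-valuedness gives injectivity.
      G-isEncoding : IsEncoding n G
      G-isEncoding = record
        { total     = λ p → surjective (toPartition p) >>= λ ((xs , len) , t) → return (xs , return (p , len , t))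
        ; bounded   = λ {_} {xs} g → decidable-stable (length xs ℕ.≤? n) (g >>= λ (_ , len , _) → return len)
        ; respects  = λ eq g → g >>= λ (p , len , t) →
            let p′ = isFinitary-respects eq p in
            return (p′ , len , subst T (Func.cong F (Pw.refl A.refl , toPartition-cong p p′ eq)) t)
        ; single    = λ {_} {_} {ys} g g′ → ≋⁺ (g >>= λ (p , len , t) → g′ >>= λ (p′ , len′ , t′) →
            injective t (subst T (Func.cong F {y = (ys , len′) , toPartition p}
              (Pw.refl A.refl , toPartition-cong p′ p (λ _ _ → refl))) t′))
        ; injective = λ {_} {_} {_} {ys} ps g g′ x y → ≡-stable (≋⁻ ps >>= λ ps →
            g >>= λ (p , len , t) → g′ >>= λ (p′ , len′ , t′) →
            singleValued (subst T (Func.cong F {y = (ys , len′) , toPartition p} (ps , (λ _ → refl))) t) t′ >>= λ eq →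
            return (toPartition-injective p p′ eq x y))
        }

      no-bijection : ⊥
      no-bijection = Covering.distinct A lemᵉ infinite (suc N * (2 + N)) λ (f , f-distinct) → refute f f-distinct
        where
        -- The length of tuples for which the counting in the embedding of ω succeeds.
        N = suc (2 * n)
        refute : (f : Fin (suc N * (2 + N)) → A.Carrier) → Covering.Distinct A f → ⊥
        refute f f-distinct = Transfinite.impossible lemᶜ A.Carrier _==_ ==-isEquivalence G-isEncoding
            omega omega-total omega-single omega-injective omega-respects
          where
          open WithMarkers N f f-distinct
          enc-injective-N : ∀ {xs ys} → length xs ≡ N → length ys ≡ N → enc xs ≐ enc ys → xs ≋ ys
          enc-injective-N lx ly = enc-injective (ℕ.≤-reflexive lx) (ℕ.≤-reflexive ly)
          markers-differ : ¬ T (marker zero zero == marker zero (suc zero))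
          markers-differ p with marker-injective {zero} {zero} {zero} {suc zero} p
          ... | ()
          open Omega.Embedding lemᶜ A.Carrier _==_ ==-isEquivalence
            G-isEncoding enc enc-finitary enc-cong enc-injective-N markers-differ

theorem2p7 : ∀ {c e : Level} → ClassicalLogic (c ⊔ e) →
    (A : Setoid c e) → Infinite A →
    (n : ℕ) → ∣ seq≤ n A ∣<∣ Part-fin A ∣
theorem2p7 lem A infinite n =
  Bridge.injection lem A infinite n ,
  λ bijection → bijection λ (F , F-bijection) → Bridge.no-bijection lem A infinite F F-bijection
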